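{- There is a function $f(n) = O(\mathrm{polylog}\, n)$ and a constant $c > 0$ such that for every parameter $\epsilon \in [0,1]$ and every $n$-node unweighted undirected graph $G = (V,E)$, there exists a subgraph $H$ of $G$ on the same vertex set $V$ with at most $c\, n^{1+\epsilon}$ edges such that for all $u, v \in V$, $$\delta_G(u,v) \le \delta_H(u,v) \le \delta_G(u,v) + f(n)\, n^{1/2 - \epsilon/2}.$$ That is, every graph has an additive spanner on $O(n^{1+\epsilon})$ edges with additive distortion $\tilde{O}(n^{1/2-\epsilon/2})$.
   Context: All graphs are undirected and unweighted with $n$ nodes. $\delta_G(u,v)$ denotes the shortest-path distance between $u$ and $v$ in $G$. The notation $\tilde{O}(g(n))$ means $O(g(n)\cdot \mathrm{polylog}\, n)$. A subgraph $H$ of $G$ on the same vertex set with $\delta_H(u,v) \le \delta_G(u,v) + \beta$ for all $u,v$ is called an additive spanner with additive distortion $\beta$. -}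

module Defs where

open import Level using (0ℓ)
open import Data.Empty using (⊥)
open import Data.Unit using (⊤)
open import Data.Fin as Fin using (Fin; zero; suc; toℕ)
import Data.Fin.Properties as Fin
open import Data.Integer as ℤ using (+_; -[1+_])
open import Data.List using (List; length; filter; allFin; cartesianProduct)
open import Data.Nat as ℕ using (ℕ; zero; suc; _*_; _^_; _∸_)
open import Data.Nat.Induction using (<-rec)
open import Data.Nat.Logarithm using (⌊log₂_⌋)
import Data.Nat.Properties as ℕ
open import Data.Product using (∃; _×_; _,_; proj₁)
open import Data.Rational as ℚ using (ℚ; 0ℚ; 1ℚ; ½; ↥_; ↧ₙ_)
import Data.Rational.Properties as ℚ
open import Data.Sum as Sum using (_⊎_; inj₁; inj₂)
open import Function using (_∘_)
open import Relation.Binary.Core using (Rel)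
open import Relation.Binary.Definitions using (Decidable; Symmetric; tri<; tri≈; tri>)
open import Relation.Binary.PropositionalEquality
open import Relation.Nullary using (¬_; Dec; yes; no)
open import Relation.Nullary.Decidable using (map′; _×-dec_)
open import Relation.Nullary.Construct.Add.Supremum using (_⁺; ⊤⁺; [_])
open import Relation.Binary.Construct.Add.Supremum.NonStrict ℕ._≤_ using (_≤⁺_) public

-- Dedekind cuts: lower q means q < x, upper q means x < q.
record ℝ : Set₁ where
  field
    lower           : ℚ → Set
    upper           : ℚ → Set
    lower-inhabited : ∃ lower
    upper-inhabited : ∃ upper
    lower-closed    : ∀ {q r} → q ℚ.< r → lower r → lower q
    upper-closed    : ∀ {q r} → q ℚ.< r → upper q → upper r
    lower-open      : ∀ {q} → lower q → ∃ λ r → q ℚ.< r × lower r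
    upper-open      : ∀ {r} → upper r → ∃ λ q → q ℚ.< r × upper q
    disjoint        : ∀ {q} → lower q → upper q → ⊥
    located         : ∀ {q r} → q ℚ.< r → lower q ⊎ upper r

open ℝ public

infix 4 _≤ℝ_

_≤ℝ_ : ℝ → ℝ → Set
x ≤ℝ y = ∀ q → lower x q → lower y q

private
  p-1<p : ∀ p → p ℚ.+ ℚ.- 1ℚ ℚ.< p
  p-1<p p = subst (p ℚ.+ ℚ.- 1ℚ ℚ.<_) (ℚ.+-identityʳ p)
                  (ℚ.+-monoʳ-< p (ℚ.negative⁻¹ (ℚ.- 1ℚ)))

  p<p+1 : ∀ p → p ℚ.< p ℚ.+ 1ℚ
  p<p+1 p = subst (ℚ._< p ℚ.+ 1ℚ) (ℚ.+-identityʳ p)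
                  (ℚ.+-monoʳ-< p (ℚ.positive⁻¹ 1ℚ))

fromℚ : ℚ → ℝ
fromℚ p = record
  { lower           = ℚ._< p
  ; upper           = p ℚ.<_
  ; lower-inhabited = p ℚ.+ ℚ.- 1ℚ , p-1<p p
  ; upper-inhabited = p ℚ.+ 1ℚ , p<p+1 p
  ; lower-closed    = ℚ.<-trans
  ; upper-closed    = λ q<r p<q → ℚ.<-trans p<q q<r
  ; lower-open      = ℚ.<-dense
  ; upper-open      = λ p<r → let q , p<q , q<r = ℚ.<-dense p<r in q , q<r , p<q
  ; disjoint        = ℚ.<-asym
  ; located         = loc
  }
  where
  loc : ∀ {q r} → q ℚ.< r → q ℚ.< p ⊎ p ℚ.< r
  loc {q} q<r with ℚ.<-cmp q p
  ... | tri< q<p _ _    = inj₁ q<p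
  ... | tri≈ _ refl _   = inj₂ q<r
  ... | tri> _ _ p<q    = inj₂ (ℚ.<-trans p<q q<r)

0ℝ 1ℝ : ℝ
0ℝ = fromℚ 0ℚ
1ℝ = fromℚ 1ℚ

-- For an increasing bijection φ of ℚ with inverse ψ, the real ψ(x):
-- q < ψ(x) iff φ(q) < x.
private
  pull : (φ ψ : ℚ → ℚ) →
         (∀ {q r} → q ℚ.< r → φ q ℚ.< φ r) →
         (∀ {q r} → q ℚ.< r → ψ q ℚ.< ψ r) →
         (∀ q → φ (ψ q) ≡ q) → (∀ q → ψ (φ q) ≡ q) →
         ℝ → ℝ
  pull φ ψ φ< ψ< φψ ψφ x = record
    { lower           = lower x ∘ φ
    ; upper           = upper x ∘ φ
    ; lower-inhabited = let q , l = lower-inhabited x in ψ q , subst (lower x) (sym (φψ q)) l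
    ; upper-inhabited = let q , u = upper-inhabited x in ψ q , subst (upper x) (sym (φψ q)) u
    ; lower-closed    = lower-closed x ∘ φ<
    ; upper-closed    = upper-closed x ∘ φ<
    ; lower-open      = λ {q} l → let r , φq<r , l′ = lower-open x l in
        ψ r , subst (ℚ._< ψ r) (ψφ q) (ψ< φq<r) , subst (lower x) (sym (φψ r)) l′
    ; upper-open      = λ {r} u → let q , q<φr , u′ = upper-open x u in
        ψ q , subst (ψ q ℚ.<_) (ψφ r) (ψ< q<φr) , subst (upper x) (sym (φψ q)) u′
    ; disjoint        = disjoint x
    ; located         = located x ∘ φ<
    }

  cancel₁ : ∀ p q → p ℚ.+ (q ℚ.- p) ≡ q
  cancel₁ p q = trans (ℚ.+-comm p (q ℚ.- p)) (trans (ℚ.+-assoc q (ℚ.- p) p)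
    (trans (cong (q ℚ.+_) (ℚ.+-inverseˡ p)) (ℚ.+-identityʳ q)))

  cancel₂ : ∀ p q → (p ℚ.+ q) ℚ.- p ≡ q
  cancel₂ p q = trans (ℚ.+-assoc p q (ℚ.- p)) (cancel₁ p q)

  double-½ : ∀ q → ½ ℚ.* q ℚ.+ ½ ℚ.* q ≡ q
  double-½ q = trans (sym (ℚ.*-distribʳ-+ q ½ ½)) (ℚ.*-identityˡ q)

  ½-double : ∀ q → ½ ℚ.* (q ℚ.+ q) ≡ q
  ½-double q = trans (ℚ.*-distribˡ-+ ½ q q) (double-½ q)

  neg-neg : ∀ q → ℚ.- (ℚ.- q) ≡ q
  neg-neg q = trans (sym (cancel₁ q (ℚ.- (ℚ.- q))))
    (trans (cong (q ℚ.+_) (ℚ.+-inverseˡ (ℚ.- q))) (ℚ.+-identityʳ q))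

infixr 6 _+ℝ_
infix  8 -ℝ_
infix  9 _/2

-- q < p + x  iff  q - p < x
_+ℝ_ : ℚ → ℝ → ℝ
p +ℝ x = pull (ℚ._- p) (p ℚ.+_) (ℚ.+-monoˡ-< (ℚ.- p)) (ℚ.+-monoʳ-< p) (cancel₂ p) (cancel₁ p) x

-- q < x / 2  iff  q + q < x
_/2 : ℝ → ℝ
x /2 = pull (λ q → q ℚ.+ q) (½ ℚ.*_) (λ q<r → ℚ.+-mono-< q<r q<r) (ℚ.*-monoʳ-<-pos ½) double-½ ½-double x

-ℝ_ : ℝ → ℝ
-ℝ x = record
  { lower           = λ q → upper x (ℚ.- q)
  ; upper           = λ q → lower x (ℚ.- q)
  ; lower-inhabited = let q , u = upper-inhabited x in ℚ.- q , subst (upper x) (sym (neg-neg q)) u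
  ; upper-inhabited = let q , l = lower-inhabited x in ℚ.- q , subst (lower x) (sym (neg-neg q)) l
  ; lower-closed    = upper-closed x ∘ ℚ.neg-antimono-<
  ; upper-closed    = lower-closed x ∘ ℚ.neg-antimono-<
  ; lower-open      = λ {q} u → let r , r<-q , u′ = upper-open x u in
      ℚ.- r , subst (ℚ._< ℚ.- r) (neg-neg q) (ℚ.neg-antimono-< r<-q) ,
      subst (upper x) (sym (neg-neg r)) u′
  ; upper-open      = λ {q} l → let r , -q<r , l′ = lower-open x l in
      ℚ.- r , subst (ℚ.- r ℚ.<_) (neg-neg q) (ℚ.neg-antimono-< -q<r) ,
      subst (lower x) (sym (neg-neg r)) l′
  ; disjoint        = λ u l → disjoint x l u
  ; located         = λ q<r → Sum.swap (located x (ℚ.neg-antimono-< q<r))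
  }

-- m ≤ c · n ^ q for rational q = a / b: both sides are raised to the
-- power b, and a factor n ^ a with a < 0 is moved to the left.
_≤_·_^ℚ_ : ℕ → ℕ → ℕ → ℚ → Set
m ≤ c · n ^ℚ q with ↥ q
... | + a      = m ^ ↧ₙ q ℕ.≤ c ^ ↧ₙ q * n ^ a
... | -[1+ a ] = m ^ ↧ₙ q * n ^ suc a ℕ.≤ c ^ ↧ₙ q

-- m ≤ c · n ^ x for real x: for n ≥ 1, n ^ x is the infimum of n ^ q over
-- the rationals q > x.  For n = 0 and x ≥ 0 the right-hand side is 0.
_≤_·_^ℝ_ : ℕ → ℕ → ℕ → ℝ → Set
m ≤ c · n ^ℝ x = ∀ q → upper x q → m ≤ c · n ^ℚ q

-- f(n) = O(polylog n).  Since 1 ≤ ⌊log₂ n⌋ ≤ log₂ n < 2 ⌊log₂ n⌋ for n ≥ 2,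
-- rounding the logarithm affects only the constant C.
Polylog : (ℕ → ℕ) → Set
Polylog f = ∃ λ k → ∃ λ C → ∃ λ N → ∀ n → N ℕ.≤ n → f n ℕ.≤ C * ⌊log₂ n ⌋ ^ k

record Graph (n : ℕ) : Set₁ where
  field
    _~_      : Rel (Fin n) 0ℓ
    _~?_     : Decidable _~_
    ~-sym    : Symmetric _~_
    ~-irrefl : ∀ {u} → ¬ (u ~ u)

open Graph using (_~?_)

infix 4 _⊆_

_⊆_ : ∀ {n} → Graph n → Graph n → Set
H ⊆ G = ∀ {u v} → Graph._~_ H u v → Graph._~_ G u v

-- Each edge {u , v} is listed once, as the pair with u < v.
edges : ∀ {n} → Graph n → List (Fin n × Fin n)
edges {n} G = filter (λ (u , v) → (u Fin.<? v) ×-dec (_~?_ G u v))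
                     (cartesianProduct (allFin n) (allFin n))

∣E_∣ : ∀ {n} → Graph n → ℕ
∣E G ∣ = length (edges G)

data Walk {n} (G : Graph n) : ℕ → Fin n → Fin n → Set where
  nil  : ∀ {u} → Walk G 0 u u
  cons : ∀ {k u v w} → Graph._~_ G u v → Walk G k v w → Walk G (suc k) u w

IsDistance : ∀ {n} → Graph n → Fin n → Fin n → ℕ ⁺ → Set
IsDistance G u v [ d ] = Walk G d u v × (∀ k → Walk G k u v → d ℕ.≤ k)
IsDistance G u v ⊤⁺    = ∀ k → ¬ Walk G k u v

private
  module _ {n} (G : Graph n) where

    walk? : ∀ k u v → Dec (Walk G k u v)
    walk? zero    u v = map′ (λ { refl → nil }) (λ { nil → refl }) (u Fin.≟ v)
    walk? (suc k) u w =
      map′ (λ (_ , e , p) → cons e p) (λ { (cons e p) → _ , e , p })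
           (Fin.any? (λ v → (_~?_ G u v) ×-dec (walk? k v w)))

    vertex : ∀ {k u v} → Walk G k u v → Fin (suc k) → Fin n
    vertex {u = u} _          zero    = u
    vertex         (cons e p) (suc i) = vertex p i

    prefix : ∀ {k u v} (p : Walk G k u v) i → Walk G (toℕ i) u (vertex p i)
    prefix p          zero    = nil
    prefix (cons e p) (suc i) = cons e (prefix p i)

    suffix : ∀ {k u v} (p : Walk G k u v) i → Walk G (k ∸ toℕ i) (vertex p i) v
    suffix p          zero    = p
    suffix (cons e p) (suc i) = suffix p i

    append : ∀ {k l u v w} → Walk G k u v → Walk G l v w → Walk G (k ℕ.+ l) u w
    append nil        q = q
    append (cons e p) q = cons e (append p q)

    shorter : ∀ {k u v} → n ℕ.≤ k → Walk G k u v → ∃ λ l → l ℕ.< k × Walk G l u v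
    shorter {k} {v = v} n≤k p with Fin.pigeonhole (ℕ.s≤s n≤k) (vertex p)
    ... | i , j , i<j , eq =
      toℕ i ℕ.+ (k ∸ toℕ j) ,
      ℕ.<-≤-trans (ℕ.+-monoˡ-< (k ∸ toℕ j) i<j)
                  (ℕ.≤-reflexive (ℕ.m+[n∸m]≡n (ℕ.≤-pred (Fin.toℕ<n j)))) ,
      append (prefix p i) (subst (λ x → Walk G (k ∸ toℕ j) x v) (sym eq) (suffix p j))

    short : ∀ {u v} k → Walk G k u v → ∃ λ l → l ℕ.< n × Walk G l u v
    short {u} {v} = <-rec (λ k → Walk G k u v → ∃ λ l → l ℕ.< n × Walk G l u v) step
      where
      step : ∀ k → (∀ {l} → l ℕ.< k → Walk G l u v → ∃ λ l → l ℕ.< n × Walk G l u v) →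
             Walk G k u v → ∃ λ l → l ℕ.< n × Walk G l u v
      step k rec p with k ℕ.<? n
      ... | yes k<n = k , k<n , p
      ... | no  k≮n = let _ , l<k , q = shorter (ℕ.≮⇒≥ k≮n) p in rec l<k q

    search : ∀ u v N → (∃ λ d → IsDistance G u v [ d ]) ⊎ (∀ k → k ℕ.< N → ¬ Walk G k u v)
    search u v zero = inj₂ λ _ ()
    search u v (suc N) with search u v N
    ... | inj₁ d = inj₁ d
    ... | inj₂ none with walk? N u v
    ...   | yes p = inj₁ (N , p , λ k q → ℕ.≮⇒≥ λ k<N → none k k<N q)
    ...   | no ¬p = inj₂ λ k k<1+N q → Sum.[ (λ k<N → none k k<N q) , (λ { refl → ¬p q }) ]
                                         (ℕ.m≤n⇒m<n∨m≡n (ℕ.≤-pred k<1+N))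

distance : ∀ {n} (G : Graph n) u v → ∃ (IsDistance G u v)
distance {n} G u v with search G u v n
... | inj₁ (d , isD) = [ d ] , isD
... | inj₂ none      = ⊤⁺ , λ k p → let l , l<n , q = short G k p in none l l<n q

-- Shortest-path distance; ⊤⁺ when v is not reachable from u.
δ : ∀ {n} → Graph n → Fin n → Fin n → ℕ ⁺
δ G u v = proj₁ (distance G u v)

-- h ≤ g + c · n ^ x in ℕ ∪ {∞}; truncated subtraction is harmless because
-- c · n ^ x ≥ 0.
_≤_+_·_^ℝ_ : ℕ ⁺ → ℕ ⁺ → ℕ → ℕ → ℝ → Set
_     ≤ ⊤⁺    + _ · _ ^ℝ _ = ⊤
⊤⁺    ≤ [ _ ] + _ · _ ^ℝ _ = ⊥
[ h ] ≤ [ g ] + c · n ^ℝ x = (h ∸ g) ≤ c · n ^ℝ x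

{-# OPTIONS --safe #-}

-- Put K ≈ n^ε and D ≈ (n/K)^(1/2), both powers of two.  Disjoint clusters, each
-- consisting of more than K neighbours of a centre, are formed greedily until
-- every vertex has at most K unclustered neighbours.  There are at most n/K
-- clusters, and at most nK edges have an unclustered endpoint.  These edges, the
-- edges from the centres to their clusters, and an O(n)-edge spanner of
-- multiplicative stretch O(log n) are kept.
--
-- Then the pairs (u , v) are processed one by one.  A shortest u-v path is
-- rerouted through the shortest paths ("strips") kept so far: on meeting a
-- strip it follows that strip up to the last vertex it has in common with it.
-- If the rerouted path meets more than D clusters met by no earlier strip, it
-- becomes a strip itself and its edges are kept.  Hence there are s ≤ n/(KD) ≤ D
-- strips.  Each newly kept edge leaves either a vertex on no earlier strip or
-- the last common vertex with an earlier strip, so at most n + s² edges are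
-- added in total.
--
-- In the end every pair has a shortest path meeting at most D clusters that
-- touch no strip.  Walking along it, jump across each strip-touching part (at
-- additive cost O(1), through the strip) and across each of those ≤ D clusters,
-- and pay O(log n) for the edge leaving it; all other edges are kept.  The
-- distortion is thus O(D log n).
module Submission where

open import Defs
open import Data.Empty using (⊥-elim)
open import Data.Fin.Base using (Fin)
import Data.Fin.Properties as Fin
open import Data.Integer.Base as ℤ using (-[1+_])
import Data.Integer.Properties as ℤ
import Data.Integer.Solver as ℤ
open import Data.List.Base using (List; []; _∷_; _++_; length; filter; map; concat; concatMap; allFin; cartesianProduct)
open import Data.List.Membership.Propositional using (_∈_; _∉_; find; lose)
open import Data.List.Membership.Propositional.Properties
open import Data.List.Properties using (length-++; length-map; length-tabulate; length-filter; filter-accept; filter-none)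
open import Data.List.Relation.Unary.All as All using (All; []; _∷_)
import Data.List.Relation.Unary.All.Properties as All
open import Data.List.Relation.Unary.AllPairs using ([]; _∷_)
open import Data.List.Relation.Unary.Any as Any using (Any; here; there)
import Data.List.Relation.Unary.Any.Properties as Any
open import Data.List.Relation.Unary.Unique.Propositional using (Unique)
import Data.List.Relation.Unary.Unique.Propositional.Properties as Unique
open import Data.Maybe.Base using (Maybe; just; nothing; fromMaybe)
import Data.Maybe.Properties as Maybe
open import Data.Nat using (ℕ; _<_; _^_; z<s)
open import Data.Nat.Induction using (<-rec)
open import Data.Nat.Logarithm
open import Data.Nat.Properties
open import Data.Nat.Solver using (module +-*-Solver)
open import Data.Product using (∃; Σ; _×_; _,_; proj₁; proj₂; swap)
open import Data.Product.Properties using (≡-dec)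
open import Data.Rational using (ℚ; mkℚ; 0ℚ; 1ℚ; ½; ↥_; ↧ₙ_; toℚᵘ; fromℚᵘ)
import Data.Rational as ℚ
import Data.Rational.Properties as ℚ
open import Data.Rational.Unnormalised.Base as ℚᵘ using (mkℚᵘ; *<*; *≡*)
import Data.Rational.Unnormalised.Properties as ℚᵘ
open import Data.Sum as Sum using (_⊎_; inj₁; inj₂; [_,_]′)
open import Data.Unit.Base using (tt)
open import Function using (_∘_; id)
open import Level using (0ℓ)
open import Relation.Binary.Definitions using (tri<; tri≈; tri>)
open import Relation.Binary.PropositionalEquality
open import Relation.Nullary using (¬_; Dec; yes; no; contradiction)
open import Relation.Nullary.Construct.Add.Supremum using (⊤⁺; [_])
open import Relation.Nullary.Decidable using (_×-dec_; _⊎-dec_; ¬?)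
open import Relation.Unary using (Pred; Decidable)

private module ℤS = ℤ.+-*-Solver

-- Counting with lists: removal of an element, disjoint filters, duplicate-free lists.

module Counting where

  open import Data.Nat.Base

  -- Removal of one element, described by how `Any` and `All` pass between the list and the
  -- remainder; this takes the place of a permutation.
  extract : ∀ {A : Set} {P : Pred A 0ℓ} {xs : List A} → Any P xs →
            ∃ λ x → ∃ λ ys → P x × length xs ≡ suc (length ys) ×
              (∀ {Q : Pred A 0ℓ} → Any Q xs → Q x ⊎ Any Q ys) ×
              (∀ {Q : Pred A 0ℓ} → All Q xs → Q x × All Q ys)
  extract {xs = x ∷ xs} (here px) =
    x , xs , px , refl ,
    (λ { (here q) → inj₁ q ; (there q) → inj₂ q }) ,
    (λ { (q ∷ qs) → q , qs })
  extract {xs = x ∷ xs} (there p) =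
    let y , ys , py , eq , any , all = extract p in
    y , x ∷ ys , py , cong suc eq ,
    (λ { (here q) → inj₂ (here q) ; (there q) → Sum.map₂ there (any q) }) ,
    (λ { (q ∷ qs) → let qy , qys = all qs in qy , q ∷ qys })

  Unique-⊆⇒length-≤ : ∀ {A : Set} {xs ys : List A} → Unique xs →
                      (∀ {x} → x ∈ xs → x ∈ ys) → length xs ≤ length ys
  Unique-⊆⇒length-≤ [] xs⊆ys = z≤n
  Unique-⊆⇒length-≤ {xs = x ∷ xs} (x∉xs ∷ xs!) xs⊆ys with extract (xs⊆ys (here refl))
  ... | y , zs , refl , eq , any , _ = subst (suc (length xs) ≤_) (sym eq)
    (s≤s (Unique-⊆⇒length-≤ xs! λ {z} z∈xs →
      [ (λ { refl → contradiction refl (All.lookup x∉xs z∈xs) }) , id ]′ (any (xs⊆ys (there z∈xs)))))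

  module _ {A : Set} {P Q R : Pred A 0ℓ} (P? : Decidable P) (Q? : Decidable Q) (R? : Decidable R) where

    -- The source of every amortised count below: what is consumed in a round and what is left over
    -- are disjoint parts of what was there before.
    length-filter-disjoint : (∀ {x} → P x → R x) → (∀ {x} → Q x → R x) → (∀ {x} → P x → ¬ Q x) → ∀ xs →
                             length (filter P? xs) + length (filter Q? xs) ≤ length (filter R? xs)
    length-filter-disjoint P⇒R Q⇒R P⇒¬Q [] = z≤n
    length-filter-disjoint P⇒R Q⇒R P⇒¬Q (x ∷ xs)
      with ih ← length-filter-disjoint P⇒R Q⇒R P⇒¬Q xs | P? x | Q? x | R? x
    ... | yes p | yes q | _     = contradiction q (P⇒¬Q p)
    ... | yes p | no  _ | yes _ = s≤s ih
    ... | yes p | no  _ | no ¬r = contradiction (P⇒R p) ¬r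
    ... | no  _ | yes q | no ¬r = contradiction (Q⇒R q) ¬r
    ... | no  _ | no  _ | yes _ = m≤n⇒m≤1+n ih
    ... | no  _ | no  _ | no _  = ih
    ... | no  _ | yes q | yes _ =
      subst (_≤ suc (length (filter R? xs))) (sym (+-suc (length (filter P? xs)) (length (filter Q? xs)))) (s≤s ih)

  length-filter-mono : ∀ {A : Set} {P R : Pred A 0ℓ} (P? : Decidable P) (R? : Decidable R) →
                       (∀ {x} → P x → R x) → ∀ xs → length (filter P? xs) ≤ length (filter R? xs)
  length-filter-mono P? R? P⇒R xs =
    ≤-trans (m≤m+n _ _) (length-filter-disjoint P? (λ _ → no id) R? P⇒R ⊥-elim (λ _ ()) xs)

  length-concatMap-≤ : ∀ {A B : Set} (f : A → List B) {m} → (∀ x → length (f x) ≤ m) →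
                       ∀ xs → length (concatMap f xs) ≤ length xs * m
  length-concatMap-≤ f f≤m []       = z≤n
  length-concatMap-≤ f f≤m (x ∷ xs) =
    ≤-trans (≤-reflexive (length-++ (f x))) (+-mono-≤ (f≤m x) (length-concatMap-≤ f f≤m xs))

  length-allFin : ∀ n → length (allFin n) ≡ n
  length-allFin n = length-tabulate {n = n} id

  Unique⇒length-≤ : ∀ {n} {xs : List (Fin n)} → Unique xs → length xs ≤ n
  Unique⇒length-≤ {n} {xs} xs! = subst (length xs ≤_) (length-allFin n) (Unique-⊆⇒length-≤ xs! (λ {x} _ → ∈-allFin x))

open Counting

-- Walks, shortest walks and bounded distance.

module Walks {n : ℕ} where

  open import Data.Nat.Base

  open import Data.List.Membership.DecPropositional (Fin._≟_ {n}) using (_∈?_) public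

  -- Only the minimality half of `IsDistance`; the walk of length `k` is always passed separately,
  -- so that it may live in a subgraph.
  Geodesic : Graph n → ℕ → Fin n → Fin n → Set
  Geodesic G k u v = ∀ l → Walk G l u v → k ≤ l

  Near : Graph n → ℕ → Fin n → Fin n → Set
  Near G d u v = ∃ λ l → l ≤ d × Walk G l u v

  infixr 5 _++ʷ_

  _++ʷ_ : ∀ {G : Graph n} {k l u v w} → Walk G k u v → Walk G l v w → Walk G (k + l) u w
  nil      ++ʷ q = q
  cons e p ++ʷ q = cons e (p ++ʷ q)

  reverseʷ : ∀ {G : Graph n} {k u v} → Walk G k u v → Walk G k v u
  reverseʷ nil = nil
  reverseʷ {G} {suc k} {u} {v} (cons e p) =
    subst (λ l → Walk G l v u) (+-comm k 1) (reverseʷ p ++ʷ cons (Graph.~-sym G e) nil)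

  mapʷ : ∀ {G H : Graph n} → G ⊆ H → ∀ {k u v} → Walk G k u v → Walk H k u v
  mapʷ G⊆H nil        = nil
  mapʷ G⊆H (cons e p) = cons (G⊆H e) (mapʷ G⊆H p)

  vertices : ∀ {G : Graph n} {k u v} → Walk G k u v → List (Fin n)
  vertices {u = u} nil        = u ∷ []
  vertices {u = u} (cons e p) = u ∷ vertices p

  vertices-mapʷ : ∀ {G H : Graph n} (G⊆H : G ⊆ H) {k u v} (p : Walk G k u v) →
                  vertices (mapʷ {G} {H} G⊆H p) ≡ vertices p
  vertices-mapʷ G⊆H nil        = refl
  vertices-mapʷ G⊆H (cons e p) = cong (_ ∷_) (vertices-mapʷ G⊆H p)

  first∈vertices : ∀ {G : Graph n} {k u v} (p : Walk G k u v) → u ∈ vertices p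
  first∈vertices nil        = here refl
  first∈vertices (cons e p) = here refl

  Near-trans : ∀ {G d e u v w} → Near G d u v → Near G e v w → Near G (d + e) u w
  Near-trans (_ , k≤d , p) (_ , l≤e , q) = _ , +-mono-≤ k≤d l≤e , p ++ʷ q

  Near-sym : ∀ {G d u v} → Near G d u v → Near G d v u
  Near-sym (_ , k≤d , p) = _ , k≤d , reverseʷ p

  Near-map : ∀ {G H d u v} → G ⊆ H → Near G d u v → Near H d u v
  Near-map G⊆H (_ , k≤d , p) = _ , k≤d , mapʷ G⊆H p

  Near-mono : ∀ {G d e u v} → d ≤ e → Near G d u v → Near G e u v
  Near-mono d≤e (_ , k≤d , p) = _ , ≤-trans k≤d d≤e , p

  Near-edge : ∀ {G u v} → Graph._~_ G u v → Near G 1 u v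
  Near-edge e = 1 , ≤-refl , cons e nil

  split-at : ∀ {H : Graph n} {k u v x} (p : Walk H k u v) → x ∈ vertices p →
             ∃ λ i → ∃ λ j → i + j ≡ k × Walk H i u x × Walk H j x v
  split-at nil        (here refl) = 0 , 0 , refl , nil , nil
  split-at (cons e p) (here refl) = 0 , _ , refl , nil , cons e p
  split-at (cons e p) (there x∈p) =
    let i , j , eq , q , r = split-at p x∈p in suc i , j , cong suc eq , cons e q , r

  module _ {G : Graph n} where

    Geodesic-sym : ∀ {k u v} → Geodesic G k u v → Geodesic G k v u
    Geodesic-sym g l p = g l (reverseʷ p)

    Geodesic-prefix : ∀ {i j k u v w} → i + j ≡ k → Walk G j v w → Geodesic G k u w → Geodesic G i u v
    Geodesic-prefix {j = j} refl q g l p = +-cancelʳ-≤ j _ _ (g (l + j) (p ++ʷ q))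

    Geodesic-suffix : ∀ {i j k u v w} → i + j ≡ k → Walk G i u v → Geodesic G k u w → Geodesic G j v w
    Geodesic-suffix {i} refl p g l q = +-cancelˡ-≤ i _ _ (g (i + l) (p ++ʷ q))

    Geodesic-unique : ∀ {k l u v} → Walk G k u v → Walk G l u v →
                      Geodesic G k u v → Geodesic G l u v → k ≡ l
    Geodesic-unique p q g h = ≤-antisym (g _ q) (h _ p)

    -- If the first vertex occurred again, the walk from that later occurrence would be a shortcut.
    Geodesic⇒Unique-vertices : ∀ {k u v} (p : Walk G k u v) → Geodesic G k u v → Unique (vertices p)
    Geodesic⇒Unique-vertices nil        g = [] ∷ []
    Geodesic⇒Unique-vertices (cons e p) g =
      All.tabulate (λ { x∈p refl →
        let i , j , i+j≡k , _ , r = split-at p x∈p in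
        1+n≰n (≤-trans (g j r) (≤-trans (m≤n+m j i) (≤-reflexive i+j≡k))) }) ∷
      Geodesic⇒Unique-vertices p (Geodesic-suffix refl (cons e nil) g)

    -- A segment of a shortest walk is shortest. The two vertices may occur in either order, in
    -- which case the segment is reversed.
    geodesic-between : ∀ {H : Graph n} → H ⊆ G → ∀ {k u v} (p : Walk H k u v) → Geodesic G k u v →
                       ∀ {x y} → x ∈ vertices p → y ∈ vertices p →
                       ∃ λ l → Walk H l x y × Geodesic G l x y
    geodesic-between H⊆G nil g (here refl) (here refl) = 0 , nil , λ _ _ → z≤n
    geodesic-between H⊆G (cons e p) g (there x∈p) (there y∈p) =
      geodesic-between H⊆G p (Geodesic-suffix refl (cons (H⊆G e) nil) g) x∈p y∈p
    geodesic-between H⊆G p@(cons _ _) g (here refl) y∈p =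
      let i , _ , eq , q , r = split-at p y∈p in
      i , q , Geodesic-prefix eq (mapʷ H⊆G r) g
    geodesic-between H⊆G p@(cons _ _) g x∈p@(there _) (here refl) =
      let i , _ , eq , q , r = split-at p x∈p in
      i , reverseʷ q , Geodesic-sym (Geodesic-prefix eq (mapʷ H⊆G r) g)

open Walks

-- Rerouting a shortest walk through a family of vertex sets.

module Rerouting {n : ℕ} (G : Graph n) where

  open import Data.Nat.Base

  open Graph G

  -- In `leaves`, `y` is the last vertex in `S` and `q` is what follows the edge out of it. That `q`
  -- avoids `S` lets `S` be discarded; that `q` stays within `p` hands on whatever is known about
  -- the vertices of `p`.
  data LastVisit (S : List (Fin n)) {v} : ∀ {k u} → Walk G k u v → Set where
    never  : ∀ {k u} {p : Walk G k u v} → (∀ {x} → x ∈ vertices p → x ∉ S) → LastVisit S p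
    ends   : ∀ {k u} {p : Walk G k u v} → v ∈ S → LastVisit S p
    leaves : ∀ {k i j u y z} {p : Walk G k u v} → i + suc j ≡ k → y ∈ S →
             Walk G i u y → y ~ z → (q : Walk G j z v) →
             (∀ {x} → x ∈ vertices q → x ∉ S) → (∀ {x} → x ∈ vertices q → x ∈ vertices p) →
             LastVisit S p

  lastVisit : ∀ S {k u v} (p : Walk G k u v) → LastVisit S p
  lastVisit S {v = v} nil with v ∈? S
  ... | yes v∈S = ends v∈S
  ... | no  v∉S = never λ { (here refl) → v∉S }
  lastVisit S {u = u} (cons e p) with lastVisit S p
  ... | ends v∈S = ends v∈S
  ... | leaves eq y∈S q f r r∩S r⊆p = leaves (cong suc eq) y∈S (cons e q) f r r∩S (there ∘ r⊆p)
  ... | never p∩S with u ∈? S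
  ...   | yes u∈S = leaves refl u∈S nil e p p∩S there
  ...   | no  u∉S = never λ { (here refl) → u∉S ; (there x∈p) → p∩S x∈p }

  -- R k u v c: "a walk of length k from u to v can be replaced at cost c".
  -- Following a geodesic and jumping, on meeting a set S, to the last vertex
  -- of the geodesic in S, each set is used at most once.
  module _ (R : ℕ → Fin n → Fin n → ℕ → Set) (γ : ℕ) (Allowed : List (Fin n) → Set)
           (sets : List (List (Fin n))) (V : List (Fin n))
           (R-weaken : ∀ {k u v c d} → c ≤ d → R k u v c → R k u v d)
           (R-nil  : ∀ {u} → R 0 u u 0)
           (R-step : ∀ {k x z v c} → x ∈ V → ¬ Any (x ∈_) sets → x ~ z → R k z v c → R (suc k) x v c)
           (R-jump : ∀ {k S x v} → Allowed S → x ∈ S → v ∈ S →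
                     Walk G k x v → Geodesic G k x v → R k x v γ)
           (R-jump-step : ∀ {k l m S x y z v c} → k + suc l ≡ m → Allowed S → x ∈ S → y ∈ S →
                     Walk G k x y → Geodesic G k x y → y ~ z → R l z v c → R m x v (γ + c))
           where

    private
      -- `Ss` holds the sets not yet jumped through. By the last hypothesis they still account for
      -- every covered vertex ahead, because the walk avoids a set after its last visit. A jump
      -- decreases `m`; a single step keeps `m` and shortens the walk.
      go : ∀ m Ss → length Ss ≡ m → All Allowed Ss → ∀ {k u v} (p : Walk G k u v) → Geodesic G k u v →
           (∀ {x} → x ∈ vertices p → x ∈ V) → (∀ {x} → x ∈ vertices p → Any (x ∈_) sets → Any (x ∈_) Ss) → R k u v (m * γ)
      go m Ss eq ok nil g p⊆V cover = R-weaken z≤n R-nil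
      go m Ss eq ok {u = u} p@(cons e q) g p⊆V cover with Any.any? (u ∈?_) Ss
      ... | no u∉Ss = R-step (p⊆V (here refl)) (u∉Ss ∘ cover (here refl)) e
                             (go m Ss eq ok q (Geodesic-suffix refl (cons e nil) g) (p⊆V ∘ there) (cover ∘ there))
      ... | yes u∈Ss with extract u∈Ss
      go zero    Ss eq ok p g p⊆V cover | yes u∈Ss | S , Ts , u∈S , eq′ , _ = contradiction (trans (sym eq) eq′) λ ()
      go (suc m) Ss eq ok p g p⊆V cover | yes u∈Ss | S , Ts , u∈S , eq′ , any , all with all ok | lastVisit S p
      ... | _   | never p∩S = contradiction u∈S (p∩S (first∈vertices p))
      ... | okS , _ | ends v∈S = R-weaken (m≤m+n γ _) (R-jump okS u∈S v∈S p g)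
      ... | okS , okTs | leaves eqk y∈S q f r r∩S r⊆p =
        R-jump-step eqk okS u∈S y∈S q (Geodesic-prefix eqk (cons f r) g) f
          (go m Ts (suc-injective (trans (sym eq′) eq)) okTs r
             (Geodesic-suffix refl (cons f nil) (Geodesic-suffix eqk q g))
             (p⊆V ∘ r⊆p) (λ x∈r x∈sets → [ (λ x∈S → contradiction x∈S (r∩S x∈r)) , id ]′
                                 (any (cover (r⊆p x∈r) x∈sets))))

    reroute : All Allowed sets → ∀ {k u v} (p : Walk G k u v) → Geodesic G k u v →
              (∀ {x} → x ∈ vertices p → x ∈ V) → R k u v (length sets * γ)
    reroute ok p g p⊆V = go (length sets) sets refl ok p g p⊆V (λ _ → id)

-- Subgraphs given by edge lists; multiplicative spanner and clustering.

module Spanned {n : ℕ} (G : Graph n) where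

  open import Data.Nat.Base
  open +-*-Solver using (solve; _:=_; _:+_; _:*_; con)

  open Graph G
  open import Data.List.Membership.DecPropositional (≡-dec (Fin._≟_ {n}) (Fin._≟_ {n}))
    using () renaming (_∈?_ to _∈ᴱ?_)

  EdgeList : Set
  EdgeList = List (Fin n × Fin n)

  -- Listed pairs that are not edges of G are ignored.
  spanned : EdgeList → Graph n
  spanned F = record
    { _~_      = λ u v → u ~ v × ((u , v) ∈ F ⊎ (v , u) ∈ F)
    ; _~?_     = λ u v → (u ~? v) ×-dec (((u , v) ∈ᴱ? F) ⊎-dec ((v , u) ∈ᴱ? F))
    ; ~-sym    = λ (e , m) → ~-sym e , Sum.swap m
    ; ~-irrefl = λ (e , _) → ~-irrefl e
    }

  spanned⊆G : ∀ F → spanned F ⊆ G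
  spanned⊆G F = proj₁

  spanned-mono : ∀ {E F} → (∀ {e} → e ∈ E → e ∈ F) → spanned E ⊆ spanned F
  spanned-mono E⊆F (e , m) = e , Sum.map E⊆F E⊆F m

  -- `edges` lists each edge in increasing order while `F` may hold it in either order, so it is
  -- looked up in `F` together with its swapped copy.
  ∣E-spanned∣ : ∀ F → ∣E spanned F ∣ ≤ length F + length F
  ∣E-spanned∣ F = ≤-trans (Unique-⊆⇒length-≤ edges! edge∈) (≤-reflexive eq)
    where
    edges! : Unique (edges (spanned F))
    edges! = Unique.filter⁺ _ (Unique.cartesianProduct⁺ (Unique.allFin⁺ n) (Unique.allFin⁺ n))
    edge∈ : ∀ {e} → e ∈ edges (spanned F) → e ∈ F ++ map swap F
    edge∈ {u , v} e∈ with proj₂ (∈-filter⁻ _ {xs = cartesianProduct (allFin n) (allFin n)} e∈)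
    ... | _ , _ , inj₁ uv∈F = ∈-++⁺ˡ uv∈F
    ... | _ , _ , inj₂ vu∈F = ∈-++⁺ʳ F (∈-map⁺ swap vu∈F)
    eq : length (F ++ map swap F) ≡ length F + length F
    eq = trans (length-++ F) (cong (length F +_) (length-map swap F))

  -- Ball growing.

  module _ (L : ℕ) (n<2^L : n < 2 ^ L) where

    -- The result of `i` rounds of breadth-first search from `v` inside `U`, with its search tree.
    -- `growth` is what bounds the number of rounds.
    record Ball (U : List (Fin n)) (v : Fin n) (i : ℕ) : Set where
      field
        members    : List (Fin n)
        unique     : Unique members
        ⊆U         : ∀ {x} → x ∈ members → x ∈ U
        centre∈    : v ∈ members
        tree       : EdgeList
        tree-size  : length tree ≤ length members
        tree-reach : ∀ {x} → x ∈ members → Near (spanned tree) i v x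
        growth     : 2 ^ i ≤ length members

    -- A ball at which growth has stopped, with a tree that also reaches its frontier. `stretch`
    -- thus serves the edges leaving the region as well, and the region can be deleted from `U`.
    record Region (U : List (Fin n)) (v : Fin n) : Set where
      field
        members   : List (Fin n)
        unique    : Unique members
        ⊆U        : ∀ {x} → x ∈ members → x ∈ U
        centre∈   : v ∈ members
        tree      : EdgeList
        tree-size : length tree ≤ length members + length members
        stretch   : ∀ {x z} → x ∈ members → z ∈ U → x ~ z → Near (spanned tree) (L + L) x z

    module _ {U : List (Fin n)} (U! : Unique U) {v : Fin n} where

      module Step {i} (ball : Ball U v i) where
        open Ball ball

        Frontier : Pred (Fin n) 0ℓ
        Frontier x = x ∉ members × Any (_~ x) members

        frontier? : Decidable Frontier
        frontier? x = ¬? (x ∈? members) ×-dec Any.any? (_~? x) members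

        frontier : List (Fin n)
        frontier = filter frontier? U

        parentEdge : Fin n → Fin n × Fin n
        parentEdge x with Any.any? (_~? x) members
        ... | yes p = proj₁ (Any.satisfied p) , x
        -- A default that vertices of `frontier` never take.
        ... | no _  = x , x

        tree⁺ : EdgeList
        tree⁺ = map parentEdge frontier ++ tree

        tree⁺-size : length tree⁺ ≤ length frontier + length members
        tree⁺-size = begin
          length tree⁺                                        ≡⟨ length-++ (map parentEdge frontier) ⟩
          length (map parentEdge frontier) + length tree      ≡⟨ cong (_+ length tree) (length-map parentEdge frontier) ⟩
          length frontier + length tree                       ≤⟨ +-monoʳ-≤ (length frontier) tree-size ⟩
          length frontier + length members                    ∎
          where open ≤-Reasoning

        reach-members : ∀ {x} → x ∈ members → Near (spanned tree⁺) i v x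
        reach-members x∈B = Near-map (spanned-mono (∈-++⁺ʳ (map parentEdge frontier))) (tree-reach x∈B)

        parent : ∀ {x} → Any (_~ x) members → ∃ λ y → y ∈ members × y ~ x × parentEdge x ≡ (y , x)
        parent {x} p with Any.any? (_~? x) members
        ... | no ¬p = contradiction p ¬p
        ... | yes q = go q
          where
          go : ∀ {ys} (q : Any (_~ x) ys) →
               ∃ λ y → y ∈ ys × y ~ x × (proj₁ (Any.satisfied q) , x) ≡ (y , x)
          go (here y~x) = _ , here refl , y~x , refl
          go (there q)  = let y , y∈ , y~x , eq = go q in y , there y∈ , y~x , eq

        reach-frontier : ∀ {x} → x ∈ frontier → Near (spanned tree⁺) (i + 1) v x
        reach-frontier {x} x∈F =
          let _ , _ , p = ∈-filter⁻ frontier? {xs = U} x∈F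
              y , y∈B , y~x , eq = parent p
          in Near-trans (reach-members y∈B)
               (Near-edge (y~x , inj₁ (∈-++⁺ˡ (subst (_∈ _) eq (∈-map⁺ parentEdge x∈F)))))

        reach-neighbour : ∀ {x z} → x ∈ members → z ∈ U → x ~ z → Near (spanned tree⁺) (i + 1) v z
        reach-neighbour {x} {z} x∈B z∈U x~z with z ∈? members
        ... | yes z∈B = Near-mono (m≤m+n i 1) (reach-members z∈B)
        ... | no  z∉B = reach-frontier (∈-filter⁺ frontier? z∈U (z∉B , Any.map (λ { refl → x~z }) x∈B))

        region : i < L → length frontier ≤ length members → Region U v
        region i<L small = record
          { members = members ; unique = unique ; ⊆U = ⊆U ; centre∈ = centre∈ ; tree = tree⁺
          ; tree-size = ≤-trans tree⁺-size (+-monoˡ-≤ (length members) small)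
          -- The walk goes through the centre: at most `i` steps back to `v`, then at most `i + 1`
          -- steps out, and `i < L`.
          ; stretch = λ x∈B z∈U x~z →
              Near-trans (Near-sym (Near-mono (<⇒≤ i<L) (reach-members x∈B)))
                         (Near-mono (≤-trans (≤-reflexive (+-comm i 1)) i<L) (reach-neighbour x∈B z∈U x~z))
          }

        larger : length members < length frontier → Ball U v (suc i)
        larger big = record
          { members    = members ++ frontier
          ; unique     = Unique.++⁺ unique (Unique.filter⁺ frontier? U!)
              (λ (x∈B , x∈F) → proj₁ (proj₂ (∈-filter⁻ frontier? {xs = U} x∈F)) x∈B)
          ; ⊆U         = λ x∈ → [ ⊆U , (λ x∈F → proj₁ (∈-filter⁻ frontier? {xs = U} x∈F)) ]′ (∈-++⁻ members x∈)
          ; centre∈    = ∈-++⁺ˡ centre∈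
          ; tree       = tree⁺
          ; tree-size  = ≤-trans tree⁺-size (≤-reflexive (trans (+-comm (length frontier) _) (sym (length-++ members))))
          ; tree-reach = λ x∈ → Near-mono (≤-reflexive (+-comm i 1))
              ([ Near-mono (m≤m+n i 1) ∘ reach-members , reach-frontier ]′ (∈-++⁻ members x∈))
          ; growth     = ≤-trans (+-mono-≤ growth (≤-trans (≤-reflexive (+-identityʳ (2 ^ i))) (≤-trans growth (<⇒≤ big))))
                                 (≤-reflexive (sym (length-++ members)))
          }

      -- As long as the frontier outnumbers the ball, absorbing it at least doubles the ball. At
      -- `i = L` there would be at least `2 ^ L > n` distinct members, so the `f` remaining rounds
      -- suffice.
      grow : ∀ f {i} → i + f ≡ L → Ball U v i → Region U v
      grow zero {i} eq ball = contradiction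
        (≤-trans n<2^L (≤-trans (≤-reflexive (cong (2 ^_) (trans (sym eq) (+-identityʳ i)))) growth))
        (≤⇒≯ (Unique⇒length-≤ unique))
        where open Ball ball
      grow (suc f) {i} eq ball with length (Step.frontier ball) ≤? length (Ball.members ball)
      ... | yes small = Step.region ball (≤-trans (m≤m+n (suc i) f) (≤-reflexive (trans (sym (+-suc i f)) eq))) small
      ... | no  large = grow f (trans (sym (+-suc i f)) eq) (Step.larger ball (≰⇒> large))

    region-around : ∀ {U v} → Unique U → v ∈ U → Region U v
    region-around {U} {v} U! v∈U = grow U! L refl record
      { members = v ∷ [] ; unique = [] ∷ [] ; ⊆U = λ { (here refl) → v∈U } ; centre∈ = here refl
      ; tree = [] ; tree-size = z≤n ; tree-reach = λ { (here refl) → 0 , z≤n , nil } ; growth = ≤-refl }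

    private
      -- Regions are cut off one after another. An edge is served by the first region containing one
      -- of its endpoints, and the disjoint regions pay for their trees with two edges per member.
      -- `m` only bounds the recursion.
      decompose : ∀ m U → length U ≤ m → Unique U →
        ∃ λ F → length F ≤ length U + length U ×
          (∀ {x z} → x ∈ U → z ∈ U → x ~ z → Near (spanned F) (L + L) x z)
      decompose m [] _ _ = [] , z≤n , λ ()
      decompose (suc m) U@(v ∷ _) U≤m U! =
        let F , F-size , F-stretch = decompose m rest (≤-pred (≤-trans rest<U U≤m)) (Unique.filter⁺ outside? U!) in
        tree ++ F , size F F-size , λ {x} {z} x∈U z∈U x~z → stretch⁺ F F-stretch x∈U z∈U x~z (x ∈? members) (z ∈? members)
        where
        open Region (region-around U! (here refl))
        outside? : Decidable (_∉ members)
        outside? x = ¬? (x ∈? members)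
        rest : List (Fin n)
        rest = filter outside? U
        split : length members + length rest ≤ length U
        split = begin
          length members + length rest
            ≤⟨ +-monoˡ-≤ (length rest) (Unique-⊆⇒length-≤ unique (λ x∈B → ∈-filter⁺ (_∈? members) (⊆U x∈B) x∈B)) ⟩
          length (filter (_∈? members) U) + length rest
            ≤⟨ length-filter-disjoint (_∈? members) outside? (λ _ → yes tt) _ _ (λ x∈B x∉B → x∉B x∈B) U ⟩
          length (filter (λ _ → yes tt) U)
            ≤⟨ length-filter (λ _ → yes tt) U ⟩
          length U ∎
          where
          open ≤-Reasoning
        rest<U : length rest < length U
        rest<U = ≤-trans (+-monoˡ-≤ (length rest) (∈-length centre∈)) split
        size : ∀ F → length F ≤ length rest + length rest → length (tree ++ F) ≤ length U + length U
        size F F-size = begin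
          length (tree ++ F)  ≡⟨ length-++ tree ⟩
          length tree + length F  ≤⟨ +-mono-≤ tree-size F-size ⟩
          (b + b) + (r + r)   ≡⟨ solve 2 (λ b r → (b :+ b) :+ (r :+ r) := (b :+ r) :+ (b :+ r)) refl b r ⟩
          (b + r) + (b + r)  ≤⟨ +-mono-≤ split split ⟩
          length U + length U  ∎
          where
          open ≤-Reasoning
          b = length members
          r = length rest
        stretch⁺ : ∀ F → (∀ {x z} → x ∈ rest → z ∈ rest → x ~ z → Near (spanned F) (L + L) x z) →
                   ∀ {x z} → x ∈ U → z ∈ U → x ~ z → Dec (x ∈ members) → Dec (z ∈ members) →
                   Near (spanned (tree ++ F)) (L + L) x z
        stretch⁺ F F-stretch x∈U z∈U x~z (yes x∈B) _ = Near-map (spanned-mono ∈-++⁺ˡ) (stretch x∈B z∈U x~z)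
        stretch⁺ F F-stretch x∈U z∈U x~z (no _) (yes z∈B) =
          Near-map (spanned-mono ∈-++⁺ˡ) (Near-sym (stretch z∈B x∈U (~-sym x~z)))
        stretch⁺ F F-stretch x∈U z∈U x~z (no x∉B) (no z∉B) = Near-map (spanned-mono (∈-++⁺ʳ tree))
          (F-stretch (∈-filter⁺ outside? x∈U x∉B) (∈-filter⁺ outside? z∈U z∉B) x~z)

    multiplicative-spanner : ∃ λ F → length F ≤ n + n × (∀ {x z} → x ~ z → Near (spanned F) (L + L) x z)
    multiplicative-spanner =
      let F , size , stretch = decompose _ (allFin n) ≤-refl (Unique.allFin⁺ n) in
      F , subst (λ m → length F ≤ m + m) (length-allFin n) size , stretch (∈-allFin _) (∈-allFin _)

  -- Star clusters.

  module _ (K : ℕ) where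

    Free : (Fin n → Maybe (Fin n)) → Fin n → Set
    Free cl x = cl x ≡ nothing

    free? : ∀ cl → Decidable (Free cl)
    free? cl x = Maybe.≡-dec Fin._≟_ (cl x) nothing

    freeNeighbour? : ∀ cl v → Decidable (λ x → v ~ x × Free cl x)
    freeNeighbour? cl v x = (v ~? x) ×-dec free? cl x

    freeNeighbours : (Fin n → Maybe (Fin n)) → Fin n → List (Fin n)
    freeNeighbours cl v = filter (freeNeighbour? cl v) (allFin n)

    -- `cl x` is the centre of the cluster of `x`. Being adjacent to all members, a centre is never
    -- in its own cluster. In `size` the free vertices act as a potential that pays `K` for each new
    -- centre.
    record Clustering (vs : List (Fin n)) : Set where
      field
        cl         : Fin n → Maybe (Fin n)
        centres    : List (Fin n)
        star       : ∀ {x a} → cl x ≡ just a → a ~ x × a ∈ centres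
        size       : length centres * K + length (filter (free? cl) (allFin n)) ≤ n
        low-degree : ∀ {v} → v ∈ vs → length (freeNeighbours cl v) ≤ K

    clustering : ∀ vs → Clustering vs
    clustering [] = record
      { cl = λ _ → nothing ; centres = [] ; star = λ () ; low-degree = λ ()
      ; size = ≤-trans (length-filter (free? (λ _ → nothing)) (allFin n)) (≤-reflexive (length-allFin n)) }
    clustering (v ∷ vs) = extend (clustering vs)
      where
      module _ (C : Clustering vs) where
        open Clustering C

        recluster : Fin n → Maybe (Fin n)
        recluster x with freeNeighbour? cl v x
        ... | yes _ = just v
        ... | no  _ = cl x

        recluster-star : ∀ {x a} → recluster x ≡ just a → a ~ x × a ∈ v ∷ centres
        recluster-star {x} eq with freeNeighbour? cl v x
        recluster-star refl | yes (v~x , _) = v~x , here refl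
        recluster-star eq   | no  _         = let a~x , a∈ = star eq in a~x , there a∈

        recluster-free : ∀ {x} → Free recluster x → Free cl x × ¬ (v ~ x × Free cl x)
        recluster-free {x} eq with freeNeighbour? cl v x
        recluster-free () | yes _
        recluster-free eq | no ¬p = eq , ¬p

        fewer : ∀ w → length (freeNeighbours recluster w) ≤ length (freeNeighbours cl w)
        fewer w = length-filter-mono (freeNeighbour? recluster w) (freeNeighbour? cl w)
          (λ (e , f) → e , proj₁ (recluster-free f)) (allFin n)

        extend : Clustering (v ∷ vs)
        extend with length (freeNeighbours cl v) ≤? K
        ... | yes low = record
          { cl = cl ; centres = centres ; star = star ; size = size
          ; low-degree = λ { (here refl) → low ; (there w∈vs) → low-degree w∈vs } }
        ... | no high = record
          { cl = recluster ; centres = v ∷ centres ; star = recluster-star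
          ; size = begin
              (K + c * K) + length (filter (free? recluster) (allFin n))
                ≤⟨ +-monoˡ-≤ _ (+-monoˡ-≤ (c * K) (<⇒≤ (≰⇒> high))) ⟩
              (N + c * K) + length (filter (free? recluster) (allFin n))
                ≡⟨ trans (cong (_+ f) (+-comm N (c * K))) (+-assoc (c * K) N f) ⟩
              c * K + (N + length (filter (free? recluster) (allFin n)))
                ≤⟨ +-monoʳ-≤ (c * K) (length-filter-disjoint (freeNeighbour? cl v) (free? recluster) (free? cl)
                     proj₂ (proj₁ ∘ recluster-free) (λ p f → proj₂ (recluster-free f) p) (allFin n)) ⟩
              c * K + length (filter (free? cl) (allFin n))
                ≤⟨ size ⟩
              n ∎
          -- Forming the cluster leaves `v` without free neighbours, and other vertices can only
          -- lose some of theirs.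
          ; low-degree = λ
              { (here refl) → ≤-trans (≤-reflexive (cong length none)) z≤n
              ; (there {x = w} w∈vs) → ≤-trans (fewer _) (low-degree w∈vs) }
          }
          where
          open ≤-Reasoning
          c = length centres
          N = length (freeNeighbours cl v)
          f = length (filter (free? recluster) (allFin n))
          none : freeNeighbours recluster v ≡ []
          none = filter-none (freeNeighbour? recluster v)
            (All.universal (λ x (v~x , fr) → let fr′ , ¬p = recluster-free fr in ¬p (v~x , fr′)) (allFin n))

-- The base edges: stars, edges at free vertices, multiplicative spanner.

module Construction {n : ℕ} (G : Graph n) (K D L : ℕ) (n<2^L : n < 2 ^ L) where

  open import Data.Nat.Base
  open +-*-Solver using (solve; _:=_; _:+_; _:*_; con)

  open Graph G
  open Spanned G
  open Rerouting G
  open Clustering (clustering K (allFin n))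

  -- A free `x` contributes the pair `(x , x)`, which is not an edge of `G` and is therefore ignored
  -- by `spanned`.
  starEdges : EdgeList
  starEdges = map (λ x → fromMaybe x (cl x) , x) (allFin n)

  freeEdges : EdgeList
  freeEdges = concatMap (λ v → map (v ,_) (freeNeighbours K cl v)) (allFin n)

  stretchEdges : EdgeList
  stretchEdges = proj₁ (multiplicative-spanner L n<2^L)

  base : EdgeList
  base = starEdges ++ freeEdges ++ stretchEdges

  base-size : length base ≤ n + (n * K + (n + n))
  base-size = begin
    length base
      ≡⟨ trans (length-++ starEdges) (cong (length starEdges +_) (length-++ freeEdges)) ⟩
    length starEdges + (length freeEdges + length stretchEdges)
      ≤⟨ +-mono-≤ (≤-reflexive (trans (length-map _ (allFin n)) (length-allFin n)))
           (+-mono-≤ free-size (proj₁ (proj₂ (multiplicative-spanner L n<2^L)))) ⟩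
    n + (n * K + (n + n)) ∎
    where
    open ≤-Reasoning
    free-size : length freeEdges ≤ n * K
    free-size = ≤-trans
      (length-concatMap-≤ _ (λ v → ≤-trans (≤-reflexive (length-map (v ,_) (freeNeighbours K cl v)))
                                             (low-degree (∈-allFin v))) (allFin n))
      (≤-reflexive (cong (_* K) (length-allFin n)))

  module _ {F : EdgeList} (base⊆F : ∀ {e} → e ∈ base → e ∈ F) where

    star-edge : ∀ {x a} → cl x ≡ just a → Graph._~_ (spanned F) a x
    star-edge {x} {a} eq = proj₁ (star eq) , inj₁ (base⊆F (∈-++⁺ˡ
      (subst (λ m → (fromMaybe x m , x) ∈ starEdges) eq (∈-map⁺ _ (∈-allFin x)))))

    free-edge : ∀ {x z} → x ~ z → cl x ≡ nothing → Graph._~_ (spanned F) x z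
    free-edge {x} {z} x~z eq = x~z , inj₂ (base⊆F (∈-++⁺ʳ starEdges (∈-++⁺ˡ
      (∈-concatMap⁺ (λ v → map (v ,_) (freeNeighbours K cl v)) (Any.map (λ { refl → zx∈ }) (∈-allFin z))))))
      where
      zx∈ : (z , x) ∈ map (z ,_) (freeNeighbours K cl z)
      zx∈ = ∈-map⁺ (z ,_) (∈-filter⁺ (freeNeighbour? K cl z) (∈-allFin x) (~-sym x~z , eq))

    stretch-edge : ∀ {x z} → x ~ z → Near (spanned F) (L + L) x z
    stretch-edge x~z = Near-map (spanned-mono (base⊆F ∘ ∈-++⁺ʳ starEdges ∘ ∈-++⁺ʳ freeEdges))
                                (proj₂ (proj₂ (multiplicative-spanner L n<2^L)) x~z)

    cluster-near : ∀ {x y a} → cl x ≡ just a → cl y ≡ just a → Near (spanned F) 2 x y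
    cluster-near p q = Near-trans (Near-sym (Near-edge (star-edge p))) (Near-edge (star-edge q))

  -- Strips and the invariant maintained while the pairs are processed.

  Touches : List (Fin n) → Fin n → Set
  Touches V a = Any (λ x → cl x ≡ just a) V

  touches? : ∀ V → Decidable (Touches V)
  touches? V a = Any.any? (λ x → Maybe.≡-dec Fin._≟_ (cl x) (just a)) V

  newlyTouched? : ∀ V W → Decidable (λ a → Touches V a × ¬ Touches W a)
  newlyTouched? V W a = touches? V a ×-dec ¬? (touches? W a)

  newCentres : List (Fin n) → List (Fin n) → List (Fin n)
  newCentres V W = filter (newlyTouched? V W) centres

  untouched : List (Fin n) → ℕ
  untouched W = length (filter (¬? ∘ touches? W) centres)

  uncovered : List (Fin n) → ℕ
  uncovered W = length (filter (λ x → ¬? (x ∈? W)) (allFin n))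

  -- A strip is remembered only as a list of vertices. What a jump along it requires is that the
  -- kept edges preserve the distances of `G` between its vertices.
  Exact : EdgeList → List (Fin n) → Set
  Exact F S = ∀ {k x y} → x ∈ S → y ∈ S → Walk G k x y → Geodesic G k x y → Walk (spanned F) k x y

  -- The witness is a path of `G`, whose edges may well be missing from the kept graph. For an
  -- unreachable pair the condition is vacuous.
  Good : List (List (Fin n)) → Fin n → Fin n → Set
  Good strips u v = ∀ {d} → Walk G d u v → Geodesic G d u v →
    ∃ λ (p : Walk G d u v) → length (newCentres (vertices p) (concat strips)) ≤ D

  -- Two potentials. `uncovered` pays for the added edges that leave a vertex on no earlier strip,
  -- so these number at most `n`; the square covers the others. `untouched` pays `D` per strip,
  -- since a new strip touches more than `D` clusters untouched before.
  record State (ps : List (Fin n × Fin n)) : Set where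
    field
      strips      : List (List (Fin n))
      kept        : EdgeList
      base⊆kept   : ∀ {e} → e ∈ base → e ∈ kept
      exact       : All (Exact kept) strips
      kept-size   : length kept + uncovered (concat strips) ≤ length base + n + length strips * length strips
      strips-size : length strips * D + untouched (concat strips) ≤ length centres
      good        : ∀ {u v} → (u , v) ∈ ps → Good strips u v

  Good-mono : ∀ S strips {u v} → Good strips u v → Good (S ∷ strips) u v
  Good-mono S strips good p g =
    let q , few = good p g in
    q , ≤-trans (length-filter-mono (newlyTouched? (vertices q) (S ++ concat strips))
                                    (newlyTouched? (vertices q) (concat strips))
                   (λ (t , ¬t) → t , ¬t ∘ Any.++⁺ʳ S) centres) few

  module _ (F : EdgeList) (strips : List (List (Fin n))) (exact : All (Exact F) strips) where

    private
      uncovered? : Decidable (_∉ concat strips)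
      uncovered? x = ¬? (x ∈? concat strips)

    -- Every edge added to F leaves either a vertex on no strip or the last
    -- vertex of the walk on some strip.
    Rerouted : ℕ → Fin n → Fin n → ℕ → Set
    Rerouted k u v c = ∃ λ M → Σ (Walk (spanned (M ++ F)) k u v) λ p →
      length M ≤ length (filter uncovered? (vertices p)) + c

    reroute-strips : ∀ {k u v} → Walk G k u v → Geodesic G k u v → Rerouted k u v (length strips)
    -- The price of a jump is 1, for the edge by which the walk leaves the strip; the part along the
    -- strip is already in `F`.
    reroute-strips {k} {u} {v} p g = subst (Rerouted k u v) (*-identityʳ (length strips))
      (reroute Rerouted 1 (Exact F) strips (vertices p) weaken ([] , nil , z≤n) step jump jump-step exact p g id)
      where
      keepF : ∀ M → spanned F ⊆ spanned (M ++ F)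
      keepF M = spanned-mono (∈-++⁺ʳ M)
      keepM : ∀ e {M} → spanned (M ++ F) ⊆ spanned (e ∷ M ++ F)
      keepM e = spanned-mono there
      weaken : ∀ {k u v c d} → c ≤ d → Rerouted k u v c → Rerouted k u v d
      weaken c≤d (M , p , h) = M , p , ≤-trans h (+-monoʳ-≤ (length (filter uncovered? (vertices p))) c≤d)
      step : ∀ {k x z v c} → x ∈ vertices p → ¬ Any (x ∈_) strips → x ~ z → Rerouted k z v c → Rerouted (suc k) x v c
      step {x = x} {z} {c = c} _ x∉ x~z (M , p , h) =
        (x , z) ∷ M , cons (x~z , inj₁ (here refl)) (mapʷ (keepM (x , z)) p) , bound
        where
        bound : suc (length M) ≤ length (filter uncovered? (x ∷ vertices (mapʷ (keepM (x , z)) p))) + c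
        bound = begin
          suc (length M)
            ≤⟨ s≤s h ⟩
          length (x ∷ filter uncovered? (vertices p)) + c
            ≡⟨ cong (λ V → length V + c) (sym (filter-accept uncovered? (x∉ ∘ ∈-concat⁻ strips))) ⟩
          length (filter uncovered? (x ∷ vertices p)) + c
            ≡⟨ cong (λ V → length (filter uncovered? (x ∷ V)) + c) (sym (vertices-mapʷ (keepM (x , z)) p)) ⟩
          length (filter uncovered? (x ∷ vertices (mapʷ (keepM (x , z)) p))) + c ∎
          where open ≤-Reasoning
      jump : ∀ {k S x v} → Exact F S → x ∈ S → v ∈ S → Walk G k x v → Geodesic G k x v → Rerouted k x v 1
      jump ex x∈S v∈S p g = [] , ex x∈S v∈S p g , z≤n
      jump-step : ∀ {k l m S x y z v c} → k + suc l ≡ m → Exact F S → x ∈ S → y ∈ S →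
                  Walk G k x y → Geodesic G k x y → y ~ z → Rerouted l z v c → Rerouted m x v (1 + c)
      jump-step {y = y} {z} {c = c} refl ex x∈S y∈S p g y~z (M , q , h) =
        (y , z) ∷ M , r ++ʷ cons (y~z , inj₁ (here refl)) q′ , bound
        where
        q′ = mapʷ (keepM (y , z)) q
        r  = mapʷ (keepF ((y , z) ∷ M)) (ex x∈S y∈S p g)
        uncovered-++ʷ : ∀ {H : Graph n} {i j a b d} (s : Walk H i a b) (t : Walk H j b d) →
          length (filter uncovered? (vertices t)) ≤ length (filter uncovered? (vertices (s ++ʷ t)))
        uncovered-++ʷ nil t = ≤-refl
        uncovered-++ʷ {a = a} (cons e s) t with a ∈? concat strips
        ... | yes _ = uncovered-++ʷ s t
        ... | no  _ = m≤n⇒m≤1+n (uncovered-++ʷ s t)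
        e′ : Graph._~_ (spanned ((y , z) ∷ M ++ F)) y z
        e′ = y~z , inj₁ (here refl)
        bound : suc (length M) ≤ length (filter uncovered? (vertices (r ++ʷ cons e′ q′))) + suc c
        bound = begin
          suc (length M)
            ≤⟨ s≤s h ⟩
          suc (length (filter uncovered? (vertices q)) + c)
            ≡⟨ sym (+-suc _ c) ⟩
          length (filter uncovered? (vertices q)) + suc c
            ≡⟨ cong (λ V → length (filter uncovered? V) + suc c) (sym (vertices-mapʷ (keepM (y , z)) q)) ⟩
          length (filter uncovered? (vertices q′)) + suc c
            ≤⟨ +-monoˡ-≤ (suc c) (uncovered-++ʷ (cons e′ nil) q′) ⟩
          length (filter uncovered? (vertices (cons e′ q′))) + suc c
            ≤⟨ +-monoˡ-≤ (suc c) (uncovered-++ʷ r (cons e′ q′)) ⟩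
          length (filter uncovered? (vertices (r ++ʷ cons e′ q′))) + suc c ∎
          where open ≤-Reasoning

  Exact-mono : ∀ {E F S} → (∀ {e} → e ∈ E → e ∈ F) → Exact E S → Exact F S
  Exact-mono E⊆F ex x∈S y∈S p g = mapʷ (spanned-mono E⊆F) (ex x∈S y∈S p g)

  -- The segment of `p` between the two vertices is shortest in `G`, so it has the same length as
  -- any other shortest walk between them.
  Exact-vertices : ∀ {F k u v} (p : Walk (spanned F) k u v) → Geodesic G k u v → Exact F (vertices p)
  Exact-vertices {F} p g x∈p y∈p q h =
    let _ , r , h′ = geodesic-between {G = G} (spanned⊆G F) p g x∈p y∈p in
    subst (λ l → Walk (spanned F) l _ _) (Geodesic-unique (mapʷ (spanned⊆G F) r) q h′ h) r


  strengthen : ∀ {ps qs} (st : State ps) → (∀ {u v} → (u , v) ∈ qs → Good (State.strips st) u v) → State qs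
  strengthen st good = record
    { strips = strips ; kept = kept ; base⊆kept = base⊆kept ; exact = exact
    ; kept-size = kept-size ; strips-size = strips-size ; good = good }
    where open State st hiding (good)

  process : ∀ u v {ps} → State ps → State ((u , v) ∷ ps)
  process u v {ps} st with distance G u v
  ... | ⊤⁺ , unreachable = strengthen st
    λ { (here refl) p _ → contradiction p (unreachable _) ; (there uv∈) → State.good st uv∈ }
  ... | [ d ] , p , g = extend (reroute-strips kept strips exact p g)
    where
    open State st
    extend : Rerouted kept strips exact d u v (length strips) → State ((u , v) ∷ ps)
    extend (M , q , M-size) with length (newCentres (vertices q) (concat strips)) ≤? D
    ... | yes few = strengthen st λ { (here refl) → good-uv ; (there uv∈) → good uv∈ }
      where
      q⊆G = spanned⊆G (M ++ kept)
      good-uv : Good strips u v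
      good-uv r h with refl ← Geodesic-unique p r g h =
        mapʷ q⊆G q , subst (λ V → length (newCentres V (concat strips)) ≤ D) (sym (vertices-mapʷ q⊆G q)) few
    ... | no many = record
      { strips      = S ∷ strips
      ; kept        = M ++ kept
      ; base⊆kept   = ∈-++⁺ʳ M ∘ base⊆kept
      ; exact       = Exact-vertices q g ∷ All.map (Exact-mono (∈-++⁺ʳ M)) exact
      ; kept-size   = kept-size⁺
      ; strips-size = strips-size⁺
      ; good        = λ { (here refl) → good-uv ; (there uv∈) → Good-mono S strips (good uv∈) }
      }
      where
      open ≤-Reasoning
      S = vertices q
      W = concat strips
      s = length strips
      q⊆G = spanned⊆G (M ++ kept)
      outside? : Decidable (_∉ W)
      outside? x = ¬? (x ∈? W)
      new? : Decidable (λ x → x ∈ S × x ∉ W)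
      new? x = (x ∈? S) ×-dec outside? x
      S! : Unique S
      S! = subst Unique (vertices-mapʷ q⊆G q) (Geodesic⇒Unique-vertices (mapʷ q⊆G q) g)
      -- The vertices of a shortest path are distinct, so each charged position is a different
      -- vertex that ceases to be uncovered.
      new-covered : length (filter outside? S) + uncovered (S ++ W) ≤ uncovered W
      new-covered = begin
        length (filter outside? S) + uncovered (S ++ W)
          ≤⟨ +-monoˡ-≤ (uncovered (S ++ W)) (Unique-⊆⇒length-≤ (Unique.filter⁺ outside? S!)
               (λ {x} x∈ → ∈-filter⁺ new? (∈-allFin x) (∈-filter⁻ outside? {xs = S} x∈))) ⟩
        length (filter new? (allFin n)) + uncovered (S ++ W)
          ≤⟨ length-filter-disjoint new? (λ x → ¬? (x ∈? (S ++ W))) outside? proj₂ (_∘ ∈-++⁺ʳ S)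
               (λ (x∈S , _) x∉ → x∉ (∈-++⁺ˡ x∈S)) (allFin n) ⟩
        uncovered W ∎
      kept-size⁺ : length (M ++ kept) + uncovered (S ++ W) ≤ length base + n + suc s * suc s
      kept-size⁺ = begin
        length (M ++ kept) + uncovered (S ++ W)
          ≡⟨ cong (_+ uncovered (S ++ W)) (length-++ M) ⟩
        length M + length kept + uncovered (S ++ W)
          ≤⟨ +-monoˡ-≤ (uncovered (S ++ W)) (+-monoˡ-≤ (length kept) M-size) ⟩
        length (filter outside? S) + s + length kept + uncovered (S ++ W)
          ≡⟨ solve 4 (λ a s k u → a :+ s :+ k :+ u := k :+ (a :+ u) :+ s) refl
               (length (filter outside? S)) s (length kept) (uncovered (S ++ W)) ⟩
        length kept + (length (filter outside? S) + uncovered (S ++ W)) + s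
          ≤⟨ +-monoˡ-≤ s (≤-trans (+-monoʳ-≤ (length kept) new-covered) kept-size) ⟩
        length base + n + s * s + s
          -- The `s` edges charged to earlier strips fit into the difference of the squares of
          -- `s + 1` and `s`.
          ≤⟨ m≤m+n _ (suc s) ⟩
        length base + n + s * s + s + suc s
          ≡⟨ solve 2 (λ a s → a :+ s :* s :+ s :+ (con 1 :+ s) := a :+ (con 1 :+ s) :* (con 1 :+ s)) refl (length base + n) s ⟩
        length base + n + suc s * suc s ∎
      strips-size⁺ : suc s * D + untouched (S ++ W) ≤ length centres
      strips-size⁺ = begin
        D + s * D + untouched (S ++ W)
          ≤⟨ +-monoˡ-≤ (untouched (S ++ W)) (+-monoˡ-≤ (s * D) (<⇒≤ (≰⇒> many))) ⟩
        length (newCentres S W) + s * D + untouched (S ++ W)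
          ≡⟨ solve 3 (λ a b c → a :+ b :+ c := b :+ (a :+ c)) refl (length (newCentres S W)) (s * D) (untouched (S ++ W)) ⟩
        s * D + (length (newCentres S W) + untouched (S ++ W))
          ≤⟨ +-monoʳ-≤ (s * D) (length-filter-disjoint (newlyTouched? S W) (¬? ∘ touches? (S ++ W)) (¬? ∘ touches? W)
               proj₂ (_∘ Any.++⁺ʳ S) (λ (t , _) ¬t → ¬t (Any.++⁺ˡ t)) centres) ⟩
        s * D + untouched W
          ≤⟨ strips-size ⟩
        length centres ∎
      none : newCentres S (S ++ W) ≡ []
      none = filter-none (newlyTouched? S (S ++ W)) (All.universal (λ a (t , ¬t) → ¬t (Any.++⁺ˡ t)) centres)
      -- Once the path is itself a strip, none of its clusters counts as new.
      good-uv : Good (S ∷ strips) u v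
      good-uv r h with refl ← Geodesic-unique p r g h =
        mapʷ q⊆G q , ≤-trans (≤-reflexive (cong length
          (trans (cong (λ V → newCentres V (S ++ W)) (vertices-mapʷ q⊆G q)) none))) z≤n

  run : ∀ ps → State ps
  run [] = record
    { strips = [] ; kept = base ; base⊆kept = id ; exact = []
    ; kept-size = ≤-trans (+-monoʳ-≤ (length base) (≤-trans (length-filter _ (allFin n)) (≤-reflexive (length-allFin n))))
                          (m≤m+n (length base + n) 0)
    ; strips-size = length-filter _ centres ; good = λ () }
  run ((u , v) ∷ ps) = process u v (run ps)

  -- Size and distortion of the final subgraph.

  module _ .{{_ : NonZero K}} .{{_ : NonZero D}} (n≤D²K : n ≤ D * D * K) where

    open State (run (cartesianProduct (allFin n) (allFin n)))

    private
      s = length strips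

      centres-size : length centres * K ≤ n
      centres-size = ≤-trans (m≤m+n _ _) size

      s*D≤centres : s * D ≤ length centres
      s*D≤centres = ≤-trans (m≤m+n _ _) strips-size

      -- `D * K` is cancelled from the chain `s * D * K ≤ n ≤ D * D * K`.
      s≤D : s ≤ D
      s≤D = *-cancelʳ-≤ s D D (*-cancelʳ-≤ (s * D) (D * D) K
        (≤-trans (*-monoˡ-≤ K s*D≤centres) (≤-trans centres-size n≤D²K)))

    spanner : Graph n
    spanner = spanned kept

    -- In units of `n * K`: four for the base edges, one for covering vertices, one for `s * s ≤ n`;
    -- then doubled by `∣E-spanned∣`.
    spanner-size : ∣E spanner ∣ ≤ 12 * (n * K)
    spanner-size = begin
      ∣E spanner ∣                                    ≤⟨ ∣E-spanned∣ kept ⟩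
      length kept + length kept                       ≤⟨ +-mono-≤ kept≤ kept≤ ⟩
      6 * (n * K) + 6 * (n * K)                       ≡⟨ solve 1 (λ a → con 6 :* a :+ con 6 :* a := con 12 :* a) refl (n * K) ⟩
      12 * (n * K)                                    ∎
      where
      open ≤-Reasoning
      n≤nK : n ≤ n * K
      n≤nK = m≤m*n n K
      s²≤n : s * s ≤ n
      s²≤n = begin
        s * s               ≤⟨ *-monoʳ-≤ s s≤D ⟩
        s * D               ≤⟨ s*D≤centres ⟩
        length centres      ≤⟨ m≤m*n (length centres) K ⟩
        length centres * K  ≤⟨ centres-size ⟩
        n                   ∎
      kept≤ : length kept ≤ 6 * (n * K)
      kept≤ = begin
        length kept
          ≤⟨ ≤-trans (m≤m+n _ _) kept-size ⟩
        length base + n + s * s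
          ≤⟨ +-mono-≤ (+-mono-≤ base-size n≤nK) (≤-trans s²≤n n≤nK) ⟩
        n + (n * K + (n + n)) + n * K + n * K
          ≤⟨ +-monoˡ-≤ (n * K) (+-monoˡ-≤ (n * K) (+-mono-≤ n≤nK (+-monoʳ-≤ (n * K) (+-mono-≤ n≤nK n≤nK)))) ⟩
        n * K + (n * K + (n * K + n * K)) + n * K + n * K
          ≡⟨ solve 1 (λ a → a :+ (a :+ (a :+ a)) :+ a :+ a := con 6 :* a) refl (n * K) ⟩
        6 * (n * K) ∎

    private
      inCluster? : ∀ a → Decidable (λ x → cl x ≡ just a)
      inCluster? a x = Maybe.≡-dec Fin._≟_ (cl x) (just a)

      inHull? : ∀ S → Decidable (λ x → Any (λ a → cl x ≡ just a × Touches S a) centres)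
      inHull? S x = Any.any? (λ a → inCluster? a x ×-dec touches? S a) centres

      cluster : Fin n → List (Fin n)
      cluster a = filter (inCluster? a) (allFin n)

      -- The union of the clusters touching `S`. Free vertices of `S` stay outside, as all edges at
      -- them are kept.
      hull : List (Fin n) → List (Fin n)
      hull S = filter (inHull? S) (allFin n)

      -- 8 = (2 + 2) + (2 + 2): two detours inside a cluster, each of which also
      -- lengthens the part along the strip.
      NearExact : List (Fin n) → Set
      NearExact S = ∀ {k x y} → x ∈ S → y ∈ S → Walk G k x y → Near spanner (k + 8) x y

      cluster-nearExact : ∀ a → NearExact (cluster a)
      cluster-nearExact a {k} x∈ y∈ _ = Near-mono (≤-trans (s≤s (s≤s z≤n)) (m≤n+m 8 k))
        (cluster-near base⊆kept (proj₂ (∈-filter⁻ (inCluster? a) {xs = allFin n} x∈))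
                                (proj₂ (∈-filter⁻ (inCluster? a) {xs = allFin n} y∈)))

      near-strip : ∀ {S x} → x ∈ hull S → ∃ λ z → z ∈ S × Near spanner 2 x z
      near-strip {S} {x} x∈ =
        let _ , h = ∈-filter⁻ (inHull? S) {xs = allFin n} x∈
            a , p , t = Any.satisfied h
            z , z∈S , q = find t
        in z , z∈S , cluster-near base⊆kept p q

      detour : ∀ {k x x′ y y′} → Near spanner 2 x x′ → Walk G k x y → Near spanner 2 y y′ →
               Near G (2 + (k + 2)) x′ y′
      detour xx′ p yy′ = Near-trans (Near-sym (Near-map (spanned⊆G kept) xx′))
        (Near-trans (_ , ≤-refl , p) (Near-map (spanned⊆G kept) yy′))

      hull-nearExact : ∀ {S} → Exact kept S → NearExact (hull S)
      hull-nearExact {S} ex {k} x∈ y∈ p with near-strip x∈ | near-strip y∈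
      ... | x′ , x′∈S , xx′ | y′ , y′∈S , yy′ with distance G x′ y′
      ...   | ⊤⁺ , unreachable = contradiction (proj₂ (proj₂ (detour xx′ p yy′))) (unreachable _)
      ...   | [ d ] , q , g = Near-mono bound
              (Near-trans xx′ (Near-trans (d , ≤-refl , ex x′∈S y′∈S q g) (Near-sym yy′)))
        where
        bound : 2 + (d + 2) ≤ k + 8
        bound = ≤-trans (+-monoʳ-≤ 2 (+-monoˡ-≤ 2 (≤-trans (g _ (proj₂ (proj₂ (detour xx′ p yy′)))) (proj₁ (proj₂ (detour xx′ p yy′))))))
          (≤-reflexive (solve 1 (λ k → con 2 :+ (con 2 :+ (k :+ con 2) :+ con 2) := k :+ con 8) refl k))

    -- `reroute` is applied to the hulls of the `s ≤ D` strips and the at most `D` clusters that are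
    -- new on the path. Each set costs 8 for crossing it and `L + L` for the edge leaving it.
    spanner-distortion : ∀ {d u v} → Walk G d u v → Geodesic G d u v →
                         Near spanner (d + (D + D) * (8 + (L + L))) u v
    spanner-distortion {d} {u} {v} p₀ g =
      let p , few = good (∈-cartesianProduct⁺ (∈-allFin u) (∈-allFin v)) p₀ g
          V    = vertices p
          new  = newCentres V (concat strips)
          sets = map hull strips ++ map cluster new
      in Near-mono (+-monoʳ-≤ d (*-monoˡ-≤ (8 + (L + L)) (begin
           length sets ≡⟨ trans (length-++ (map hull strips)) (cong₂ _+_ (length-map hull strips) (length-map cluster new)) ⟩
           s + length new ≤⟨ +-mono-≤ s≤D few ⟩
           D + D ∎)))
         (reroute R (8 + (L + L)) NearExact sets V (λ {k} {_} {_} {c} → weaken {k} {c = c}) (0 , z≤n , nil) (λ {k} {_} {_} {_} {c} → step p {k} {c = c}) jump jump-step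
           (All.++⁺ (All.map⁺ (All.map hull-nearExact exact)) (All.map⁺ (All.universal cluster-nearExact new)))
           p g id)
      where
      open ≤-Reasoning
      R : ℕ → Fin n → Fin n → ℕ → Set
      R k u v c = Near spanner (k + c) u v
      weaken : ∀ {k u v c d} → c ≤ d → R k u v c → R k u v d
      weaken {k} c≤d = Near-mono (+-monoʳ-≤ k c≤d)
      -- A path vertex outside all the sets is free: its cluster would either touch a strip, putting
      -- it in a hull, or be new on the path.
      step : ∀ {i a b} (p : Walk G i a b) {k x z v c} → x ∈ vertices p →
             ¬ Any (x ∈_) (map hull strips ++ map cluster (newCentres (vertices p) (concat strips))) →
             x ~ z → R k z v c → R (suc k) x v c
      step p {x = x} x∈p x∉sets x~z r with cl x in eq
      ... | nothing = Near-trans (Near-edge (free-edge base⊆kept x~z eq)) r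
      ... | just a with touches? (concat strips) a
      ...   | yes t = contradiction (Any.++⁺ˡ (Any.map⁺ (Any.map
                (λ {S} t → ∈-filter⁺ (inHull? S) (∈-allFin x) (lose (proj₂ (star eq)) (eq , t))) (Any.concat⁻ strips t)))) x∉sets
      ...   | no ¬t = contradiction (Any.++⁺ʳ (map hull strips) (Any.map⁺ (lose
                (∈-filter⁺ (newlyTouched? (vertices p) (concat strips)) (proj₂ (star eq)) (lose x∈p eq , ¬t))
                (∈-filter⁺ (inCluster? a) (∈-allFin x) eq)))) x∉sets
      jump : ∀ {k S x v} → NearExact S → x ∈ S → v ∈ S → Walk G k x v → Geodesic G k x v → R k x v (8 + (L + L))
      jump {k} ex x∈S v∈S p _ = Near-mono (+-monoʳ-≤ k (m≤m+n 8 (L + L))) (ex x∈S v∈S p)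
      jump-step : ∀ {k l m S x y z v c} → k + suc l ≡ m → NearExact S → x ∈ S → y ∈ S →
                  Walk G k x y → Geodesic G k x y → y ~ z → R l z v c → R m x v (8 + (L + L) + c)
      jump-step {k} {l} {c = c} refl ex x∈S y∈S p _ y~z r = Near-mono
        -- The slack of 1 is the edge from `y` to `z`, which counts in the length of the original
        -- walk.
        (≤-trans (n≤1+n _) (≤-reflexive (solve 4 (λ k l L c → con 1 :+ (k :+ con 8 :+ (L :+ L :+ (l :+ c)))
                                                  := k :+ (con 1 :+ l) :+ (con 8 :+ (L :+ L) :+ c)) refl k l L c)))
        (Near-trans (ex x∈S y∈S p) (Near-trans (stretch-edge base⊆kept y~z) r))

-- Powers of two, logarithms and real exponents.

module Exponents where

  open import Data.Nat.Base
  open +-*-Solver using (solve; _:=_; _:+_; _:*_; con)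

  n<2^[1+⌊log₂n⌋] : ∀ n → n < 2 ^ suc ⌊log₂ n ⌋
  n<2^[1+⌊log₂n⌋] n = ≰⇒> λ 2^≤n →
    1+n≰n (subst (_≤ ⌊log₂ n ⌋) (⌊log₂[2^n]⌋≡n (suc ⌊log₂ n ⌋)) (⌊log₂⌋-mono-≤ 2^≤n))

  1≤⌊log₂n⌋ : ∀ {n} → 2 ≤ n → 1 ≤ ⌊log₂ n ⌋
  1≤⌊log₂n⌋ = ⌊log₂⌋-mono-≤ {2}

  2^⌊log₂n⌋≤n : ∀ n .{{_ : NonZero n}} → 2 ^ ⌊log₂ n ⌋ ≤ n
  2^⌊log₂n⌋≤n n = <-rec (λ n → 1 ≤ n → 2 ^ ⌊log₂ n ⌋ ≤ n) step n (>-nonZero⁻¹ n)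
    where
    step : ∀ n → (∀ {m} → m < n → 1 ≤ m → 2 ^ ⌊log₂ m ⌋ ≤ m) → 1 ≤ n → 2 ^ ⌊log₂ n ⌋ ≤ n
    step 1 rec _ = ≤-refl
    step n@(suc (suc m)) rec _ = begin
      2 ^ ⌊log₂ n ⌋              ≡⟨ cong (2 ^_) (sym (m+[n∸m]≡n (1≤⌊log₂n⌋ {n} (s≤s (s≤s z≤n))))) ⟩
      2 * 2 ^ (⌊log₂ n ⌋ ∸ 1)    ≡⟨ cong (λ l → 2 * 2 ^ l) (sym (⌊log₂⌊n/2⌋⌋≡⌊log₂n⌋∸1 n)) ⟩
      2 * 2 ^ ⌊log₂ ⌊ n /2⌋ ⌋    ≤⟨ *-monoʳ-≤ 2 (rec (⌊n/2⌋<n (suc m)) (s≤s z≤n)) ⟩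
      ⌊ n /2⌋ + (⌊ n /2⌋ + 0)    ≡⟨ cong (⌊ n /2⌋ +_) (+-identityʳ ⌊ n /2⌋) ⟩
      ⌊ n /2⌋ + ⌊ n /2⌋          ≤⟨ +-monoʳ-≤ ⌊ n /2⌋ (⌊n/2⌋≤⌈n/2⌉ n) ⟩
      ⌊ n /2⌋ + ⌈ n /2⌉          ≡⟨ ⌊n/2⌋+⌈n/2⌉≡n n ⟩
      n                          ∎
      where open ≤-Reasoning

  ^-distribʳ-* : ∀ o m n → (m * n) ^ o ≡ m ^ o * n ^ o
  ^-distribʳ-* zero    m n = refl
  ^-distribʳ-* (suc o) m n = trans (cong (m * n *_) (^-distribʳ-* o m n))
    (solve 4 (λ m n a b → m :* n :* (a :* b) := m :* a :* (n :* b)) refl m n (m ^ o) (n ^ o))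

  -- The factor `e` may depend on `n`; this is how the logarithm enters the coefficient of the
  -- distortion.
  ^ℝ-scale : ∀ e {m c n x m′} → m ≤ c · n ^ℝ x → m′ ≤ e * m → m′ ≤ (e * c) · n ^ℝ x
  ^ℝ-scale e {m} {c} {n} {x} {m′} h m′≤em q u with ↥ q | h q u
  ... | ℤ.+ a | h′ = begin
    m′ ^ b                     ≤⟨ ^-monoˡ-≤ b m′≤em ⟩
    (e * m) ^ b                ≡⟨ ^-distribʳ-* b e m ⟩
    e ^ b * m ^ b              ≤⟨ *-monoʳ-≤ (e ^ b) h′ ⟩
    e ^ b * (c ^ b * n ^ a)    ≡⟨ sym (*-assoc (e ^ b) (c ^ b) (n ^ a)) ⟩
    e ^ b * c ^ b * n ^ a      ≡⟨ cong (_* n ^ a) (sym (^-distribʳ-* b e c)) ⟩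
    (e * c) ^ b * n ^ a        ∎
    where
    open ≤-Reasoning
    b = ↧ₙ q
  ... | -[1+ a ] | h′ = begin
    m′ ^ b * n ^ suc a             ≤⟨ *-monoˡ-≤ (n ^ suc a) (^-monoˡ-≤ b m′≤em) ⟩
    (e * m) ^ b * n ^ suc a        ≡⟨ cong (_* n ^ suc a) (^-distribʳ-* b e m) ⟩
    e ^ b * m ^ b * n ^ suc a      ≡⟨ *-assoc (e ^ b) (m ^ b) (n ^ suc a) ⟩
    e ^ b * (m ^ b * n ^ suc a)    ≤⟨ *-monoʳ-≤ (e ^ b) h′ ⟩
    e ^ b * c ^ b                  ≡⟨ sym (^-distribʳ-* b e c) ⟩
    (e * c) ^ b                    ∎
    where
    open ≤-Reasoning
    b = ↧ₙ q

  ^ℚ-nonNegative : ∀ {m c n} q {a} → ↥ q ≡ ℤ.+ a → m ^ ↧ₙ q ≤ c ^ ↧ₙ q * n ^ a → m ≤ c · n ^ℚ q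
  ^ℚ-nonNegative q eq h with ↥ q
  ^ℚ-nonNegative q refl h | _ = h

  zero-≤-^ℝ : ∀ c n x → 0 ≤ c · n ^ℝ x
  zero-≤-^ℝ c n x (mkℚ (ℤ.+ a) d _)  u = z≤n
  zero-≤-^ℝ c n x (mkℚ -[1+ a ] d _) u = z≤n

  lower<upper : ∀ x {q r} → lower x q → upper x r → q ℚ.< r
  lower<upper x {q} {r} l u with ℚ.<-cmp q r
  ... | tri< q<r _ _  = q<r
  ... | tri≈ _ refl _ = ⊥-elim (disjoint x l u)
  ... | tri> _ _ r<q  = ⊥-elim (disjoint x (lower-closed x r<q l) u)

  -- Approximating the real exponent by fractions with a given denominator.

  module Grid (ε : ℝ) (0≤ε : 0ℝ ≤ℝ ε) (ε≤1 : ε ≤ℝ 1ℝ) where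

    -- The bound concerns any unnormalised fraction `p` equal to `r`, because numerators of sums in
    -- `ℚ` are hidden behind normalisation.
    upper-nonNegative : ∀ {p r} → toℚᵘ r ℚᵘ.≃ p → upper ε r → ℤ.0ℤ ℤ.≤ ℚᵘ.↥ p
    upper-nonNegative {p} {r} r≃p u = subst (ℤ.0ℤ ℤ.≤_) (ℤ.*-identityʳ (ℚᵘ.↥ p))
      (ℚᵘ.drop-*≤* (ℚᵘ.≤-respʳ-≃ r≃p (ℚ.toℚᵘ-mono-≤ {0ℚ} 0≤r)))
      where
      0≤r : 0ℚ ℚ.≤ r
      0≤r = ℚ.≮⇒≥ λ r<0 → disjoint ε (0≤ε r r<0) u

    lower-<1 : ∀ {p r} → toℚᵘ r ℚᵘ.≃ p → lower ε r → ℚᵘ.↥ p ℤ.< ℚᵘ.↧ p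
    lower-<1 {p} {r} r≃p l = subst₂ ℤ._<_ (ℤ.*-identityʳ (ℚᵘ.↥ p)) (ℤ.*-identityˡ (ℚᵘ.↧ p))
      (ℚᵘ.drop-*<* (ℚᵘ.<-respˡ-≃ r≃p (ℚ.toℚᵘ-mono-< (ε≤1 r l))))

    -- (k - 1) / ℓ ≤ ε
    AtLeast : ℕ → ℕ → Set
    AtLeast ℓ k = ∀ {p r} → toℚᵘ r ℚᵘ.≃ p → upper ε r →
      ℤ.+ k ℤ.* ℚᵘ.↧ p ℤ.≤ ℚᵘ.↥ p ℤ.* ℤ.+ ℓ ℤ.+ ℚᵘ.↧ p

    -- ε ≤ (k + 1) / ℓ
    AtMost : ℕ → ℕ → Set
    AtMost ℓ k = ∀ {p r} → toℚᵘ r ℚᵘ.≃ p → lower ε r →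
      ℚᵘ.↥ p ℤ.* ℤ.+ ℓ ℤ.≤ ℤ.+ suc k ℤ.* ℚᵘ.↧ p

    AtLeast-zero : ∀ ℓ → AtLeast ℓ 0
    AtLeast-zero ℓ {p} r≃p u = ℤ.+-mono-≤
      (ℤ.*-monoʳ-≤-nonNeg (ℤ.+ ℓ) (upper-nonNegative r≃p u)) (ℤ.+≤+ (z≤n {ℚᵘ.↧ₙ p}))

    module _ (m : ℕ) where

      private
        ℓ = suc m

        _/ℓ : ℕ → ℚ
        j /ℓ = fromℚᵘ (mkℚᵘ (ℤ.+ j) m)

        toℚᵘ-/ℓ : ∀ j → toℚᵘ (j /ℓ) ℚᵘ.≃ mkℚᵘ (ℤ.+ j) m
        toℚᵘ-/ℓ j = ℚ.toℚᵘ-fromℚᵘ (mkℚᵘ (ℤ.+ j) m)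

        /ℓ-mono : ∀ j → j /ℓ ℚ.< suc j /ℓ
        /ℓ-mono j = ℚ.toℚᵘ-cancel-< (ℚᵘ.<-respˡ-≃ (ℚᵘ.≃-sym (toℚᵘ-/ℓ j))
          (ℚᵘ.<-respʳ-≃ (ℚᵘ.≃-sym (toℚᵘ-/ℓ (suc j))) (*<* (ℤ.*-monoʳ-<-pos (ℤ.+ ℓ) (ℤ.+<+ (n<1+n j))))))

        AtLeast-suc : ∀ j → lower ε (j /ℓ) → AtLeast ℓ (suc j)
        AtLeast-suc j l {p} {r} r≃p u = ℤ.≤-trans
          (ℤ.≤-reflexive (ℤS.solve 2 (λ j b → (ℤS.con (ℤ.+ 1) ℤS.:+ j) ℤS.:* b ℤS.:= j ℤS.:* b ℤS.:+ b) refl (ℤ.+ j) (ℚᵘ.↧ p)))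
          (ℤ.+-monoˡ-≤ (ℚᵘ.↧ p) (ℤ.<⇒≤ (ℚᵘ.drop-*<* j<p)))
          where
          j<p : mkℚᵘ (ℤ.+ j) m ℚᵘ.< p
          j<p = ℚᵘ.<-respˡ-≃ (toℚᵘ-/ℓ j) (ℚᵘ.<-respʳ-≃ r≃p (ℚ.toℚᵘ-mono-< (lower<upper ε l u)))

        AtMost-upper : ∀ j → upper ε (suc j /ℓ) → AtMost ℓ j
        AtMost-upper j u {p} {r} r≃p l = ℤ.<⇒≤ (ℚᵘ.drop-*<* p<j)
          where
          p<j : p ℚᵘ.< mkℚᵘ (ℤ.+ suc j) m
          p<j = ℚᵘ.<-respʳ-≃ (toℚᵘ-/ℓ (suc j)) (ℚᵘ.<-respˡ-≃ r≃p (ℚ.toℚᵘ-mono-< (lower<upper ε l u)))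

        -- An exact floor of `ε * ℓ` is not computable from a cut. Locatedness only decides between
        -- `j / ℓ < ε` and `ε < (j + 1) / ℓ`, hence the tolerance of one grid step either way. The
        -- search stops because `ε ≤ 1` excludes `ℓ / ℓ < ε`.
        search : ∀ f j → j + f ≡ ℓ → AtLeast ℓ j → ∃ λ k → k ≤ ℓ × AtLeast ℓ k × AtMost ℓ k
        search f j eq low with located ε (/ℓ-mono j)
        ... | inj₂ u = j , ≤-trans (m≤m+n j f) (≤-reflexive eq) , low , AtMost-upper j u
        search zero    j eq low | inj₁ l = contradiction (lower-<1 (toℚᵘ-/ℓ j) l)
          (ℤ.≤⇒≯ (ℤ.≤-reflexive (cong ℤ.+_ (trans (sym eq) (+-identityʳ j)))))
        search (suc f) j eq low | inj₁ l = search f (suc j) (trans (sym (+-suc j f)) eq) (AtLeast-suc j l)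

      grid-suc : ∃ λ k → k ≤ ℓ × AtLeast ℓ k × AtMost ℓ k
      grid-suc = search ℓ 0 refl (AtLeast-zero ℓ)

    grid : ∀ ℓ → ∃ λ k → k ≤ ℓ × AtLeast ℓ k × AtMost ℓ k
    grid zero    = 0 , z≤n , AtLeast-zero 0 , λ {p} _ _ →
      ℤ.≤-trans (ℤ.≤-reflexive (ℤ.*-zeroʳ (ℚᵘ.↥ p))) (ℤ.+≤+ z≤n)
    grid (suc m) = grid-suc m

    module _ {n ℓ k : ℕ} (2^ℓ≤n : 2 ^ ℓ ≤ n) where

      -- For `q = a / b` above `1 + ε`, `AtLeast` at `q - 1` gives `k * b ≤ ℓ * e + b` with
      -- `e = a - b`; the last `b` becomes the constant 2.
      edge-budget : AtLeast ℓ k → (n * 2 ^ k) ≤ 2 · n ^ℝ (1ℚ +ℝ ε)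
      edge-budget low q@(mkℚ a d _) u = ^ℚ-nonNegative q a≡ (begin
        (n * 2 ^ k) ^ b                ≡⟨ ^-distribʳ-* b n (2 ^ k) ⟩
        n ^ b * (2 ^ k) ^ b            ≡⟨ cong (n ^ b *_) (^-*-assoc 2 k b) ⟩
        n ^ b * 2 ^ (k * b)            ≤⟨ *-monoʳ-≤ (n ^ b) (^-monoʳ-≤ 2 kb≤) ⟩
        n ^ b * 2 ^ (ℓ * e + b)        ≡⟨ cong (n ^ b *_) (^-distribˡ-+-* 2 (ℓ * e) b) ⟩
        n ^ b * (2 ^ (ℓ * e) * 2 ^ b)  ≡⟨ cong (λ x → n ^ b * (x * 2 ^ b)) (sym (^-*-assoc 2 ℓ e)) ⟩
        n ^ b * ((2 ^ ℓ) ^ e * 2 ^ b)  ≤⟨ *-monoʳ-≤ (n ^ b) (*-monoˡ-≤ (2 ^ b) (^-monoˡ-≤ e 2^ℓ≤n)) ⟩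
        n ^ b * (n ^ e * 2 ^ b)        ≡⟨ solve 3 (λ x y z → x :* (y :* z) := z :* (y :* x)) refl (n ^ b) (n ^ e) (2 ^ b) ⟩
        2 ^ b * (n ^ e * n ^ b)        ≡⟨ cong (2 ^ b *_) (sym (^-distribˡ-+-* n e b)) ⟩
        2 ^ b * n ^ (e + b)            ∎)
        where
        open ≤-Reasoning
        b = suc d
        r≃ : toℚᵘ (q ℚ.- 1ℚ) ℚᵘ.≃ mkℚᵘ (a ℤ.- ℤ.+ b) d
        r≃ = ℚᵘ.≃-trans (ℚ.toℚᵘ-homo-+ q (ℚ.- 1ℚ)) (*≡* (ℤS.solve 2
          (λ a b → (a ℤS.:* ℤS.con (ℤ.+ 1) ℤS.:+ ℤS.con (ℤ.- (ℤ.+ 1)) ℤS.:* b) ℤS.:* b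
                   ℤS.:= (a ℤS.:- b) ℤS.:* (b ℤS.:* ℤS.con (ℤ.+ 1))) refl a (ℤ.+ b)))
        e = ℤ.∣ a ℤ.- ℤ.+ b ∣
        e≡ : ℤ.+ e ≡ a ℤ.- ℤ.+ b
        e≡ = ℤ.0≤i⇒+∣i∣≡i (upper-nonNegative r≃ u)
        a≡ : a ≡ ℤ.+ (e + b)
        a≡ = trans (ℤS.solve 2 (λ a b → a ℤS.:= a ℤS.:- b ℤS.:+ b) refl a (ℤ.+ b))
               (trans (cong (ℤ._+ ℤ.+ b) (sym e≡)) (sym (ℤ.pos-+ e b)))
        kb≤ : k * b ≤ ℓ * e + b
        kb≤ = ℤ.drop‿+≤+ (subst₂ ℤ._≤_ (sym (ℤ.pos-* k b))
          (trans (cong (λ i → i ℤ.* ℤ.+ ℓ ℤ.+ ℤ.+ b) (sym e≡))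
            (trans (cong (ℤ._+ ℤ.+ b) (trans (ℤ.*-comm (ℤ.+ e) (ℤ.+ ℓ)) (sym (ℤ.pos-* ℓ e)))) (sym (ℤ.pos-+ (ℓ * e) b))))
          (low r≃ u))

      -- By the definition of the cut, `q` above the exponent means `1 - 2q < ε`, which `AtMost`
      -- bounds by `(k + 1) / ℓ`. Together with the bound on `2 * d` this gives `d ≤ 3/2 + ℓ * q`,
      -- and 3/2 is rounded up to 2.
      distance-budget : ∀ {d} → 2 * d + k ≤ 2 + ℓ → AtMost ℓ k → (2 ^ d) ≤ 4 · n ^ℝ (½ +ℝ (-ℝ (ε /2)))
      distance-budget {d} 2d+k≤ high q@(mkℚ i c _) l = bound i refl
        where
        b = suc c
        r = ℚ.- (q ℚ.- ½) ℚ.+ ℚ.- (q ℚ.- ½)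
        r≃ : toℚᵘ r ℚᵘ.≃ mkℚᵘ (ℤ.+ b ℤ.- (i ℤ.+ i)) c
        r≃ = ℚᵘ.≃-trans (ℚ.toℚᵘ-homo-+ (ℚ.- (q ℚ.- ½)) (ℚ.- (q ℚ.- ½)))
          (ℚᵘ.≃-trans (ℚᵘ.+-cong neg neg) (*≡* (ℤS.solve 2
            (λ a b → let x = ℤS.:- (a ℤS.:* ℤS.con (ℤ.+ 2) ℤS.:+ ℤS.con (ℤ.- (ℤ.+ 1)) ℤS.:* b) in
               let y = b ℤS.:* ℤS.con (ℤ.+ 2) in
               (x ℤS.:* y ℤS.:+ x ℤS.:* y) ℤS.:* b
               ℤS.:= (b ℤS.:- (a ℤS.:+ a)) ℤS.:* (y ℤS.:* y)) refl i (ℤ.+ b))))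
          where
          neg : toℚᵘ (ℚ.- (q ℚ.- ½)) ℚᵘ.≃ ℚᵘ.- (toℚᵘ q ℚᵘ.+ toℚᵘ (ℚ.- ½))
          neg = ℚᵘ.≃-trans (ℚ.toℚᵘ-homo‿- (q ℚ.- ½)) (ℚᵘ.-‿cong (ℚ.toℚᵘ-homo-+ q (ℚ.- ½)))
        -- A negative `q` would make `1 - 2q` exceed 1, although it lies below `ε ≤ 1`.
        i≮0 : ∀ {a} → i ≢ -[1+ a ]
        i≮0 {a} refl = m+n≮m b (suc (suc (a + a))) (ℤ.drop‿+<+ (lower-<1 r≃ l))
        bound : ∀ j → i ≡ j → (2 ^ d) ≤ 4 · n ^ℚ q
        bound -[1+ a ] eq = contradiction eq i≮0
        bound (ℤ.+ a)  eq = ^ℚ-nonNegative q eq (begin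
          (2 ^ d) ^ b               ≡⟨ ^-*-assoc 2 d b ⟩
          2 ^ (d * b)               ≤⟨ ^-monoʳ-≤ 2 db≤ ⟩
          2 ^ (2 * b + ℓ * a)       ≡⟨ ^-distribˡ-+-* 2 (2 * b) (ℓ * a) ⟩
          2 ^ (2 * b) * 2 ^ (ℓ * a) ≡⟨ cong₂ _*_ (sym (^-*-assoc 2 2 b)) (sym (^-*-assoc 2 ℓ a)) ⟩
          4 ^ b * (2 ^ ℓ) ^ a       ≤⟨ *-monoʳ-≤ (4 ^ b) (^-monoˡ-≤ a 2^ℓ≤n) ⟩
          4 ^ b * n ^ a             ∎)
          where
          open ≤-Reasoning
          bℓ≤ : b * ℓ ≤ suc k * b + (a + a) * ℓ
          bℓ≤ = ℤ.drop‿+≤+ (subst₂ ℤ._≤_ lhs rhs (ℤ.+-monoˡ-≤ (ℤ.+ ((a + a) * ℓ)) (high r≃ l)))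
            where
            lhs : (ℤ.+ b ℤ.- (i ℤ.+ i)) ℤ.* ℤ.+ ℓ ℤ.+ ℤ.+ ((a + a) * ℓ) ≡ ℤ.+ (b * ℓ)
            lhs = trans (cong₂ (λ x y → (ℤ.+ b ℤ.- (x ℤ.+ x)) ℤ.* ℤ.+ ℓ ℤ.+ y) eq
                          (trans (ℤ.pos-* (a + a) ℓ) (cong (ℤ._* ℤ.+ ℓ) (ℤ.pos-+ a a))))
                    (trans (ℤS.solve 3 (λ a b l → (b ℤS.:- (a ℤS.:+ a)) ℤS.:* l ℤS.:+ (a ℤS.:+ a) ℤS.:* l
                                                  ℤS.:= b ℤS.:* l) refl (ℤ.+ a) (ℤ.+ b) (ℤ.+ ℓ))
                           (sym (ℤ.pos-* b ℓ)))
            rhs : ℤ.+ suc k ℤ.* ℤ.+ b ℤ.+ ℤ.+ ((a + a) * ℓ) ≡ ℤ.+ (suc k * b + (a + a) * ℓ)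
            rhs = trans (cong (ℤ._+ ℤ.+ ((a + a) * ℓ)) (sym (ℤ.pos-* (suc k) b))) (sym (ℤ.pos-+ (suc k * b) _))
          db≤ : d * b ≤ 2 * b + ℓ * a
          db≤ = *-cancelˡ-≤ 2 (+-cancelʳ-≤ (k * b) _ _ (begin
            2 * (d * b) + k * b             ≡⟨ solve 3 (λ d b k → con 2 :* (d :* b) :+ k :* b := (con 2 :* d :+ k) :* b) refl d b k ⟩
            (2 * d + k) * b                 ≤⟨ *-monoˡ-≤ b 2d+k≤ ⟩
            (2 + ℓ) * b                     ≡⟨ solve 2 (λ l b → (con 2 :+ l) :* b := con 2 :* b :+ b :* l) refl ℓ b ⟩
            2 * b + b * ℓ                   ≤⟨ +-monoʳ-≤ (2 * b) bℓ≤ ⟩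
            -- Rounds `3 * b` up to `4 * b`, so that the factor 2 can be cancelled.
            2 * b + (suc k * b + (a + a) * ℓ) ≤⟨ m≤m+n _ b ⟩
            2 * b + (suc k * b + (a + a) * ℓ) + b
              ≡⟨ solve 4 (λ a b k l → con 2 :* b :+ ((con 1 :+ k) :* b :+ (a :+ a) :* l) :+ b
                                      := con 2 :* (con 2 :* b :+ l :* a) :+ k :* b) refl a b k ℓ ⟩
            2 * (2 * b + ℓ * a) + k * b ∎))

open Exponents

-- Choice of the parameters and assembly of the bounds.

module AdditiveSpanners where

  open import Data.Nat.Base
  open +-*-Solver using (solve; _:=_; _:+_; _:*_; con)
  open import Relation.Binary.Construct.Add.Supremum.NonStrict _≤_ using ([_]; _≤⊤⁺)

  -- Used with `t = ℓ - k`, where `ℓ` is the rounded logarithm: the lower bound yields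
  -- `n < 2 ^ (ℓ + 1) ≤ D * D * K`, the upper one is the hypothesis of `distance-budget`.
  half : ∀ t → ∃ λ d → 1 + t ≤ 2 * d × 2 * d ≤ 2 + t
  half 0 = 1 , s≤s z≤n , ≤-refl
  half 1 = 1 , ≤-refl , s≤s (s≤s z≤n)
  half (suc (suc t)) =
    let d , lo , hi = half t
        eq = *-suc 2 d
    in suc d , ≤-trans (s≤s (s≤s lo)) (≤-reflexive (sym eq)) , ≤-trans (≤-reflexive eq) (s≤s (s≤s hi))

  record Parameters (ε : ℝ) (n : ℕ) : Set where
    field
      k d             : ℕ
      n≤D²K           : n ≤ 2 ^ d * 2 ^ d * 2 ^ k
      edge-budget     : (n * 2 ^ k) ≤ 2 · n ^ℝ (1ℚ +ℝ ε)
      distance-budget : (2 ^ d) ≤ 4 · n ^ℝ (½ +ℝ (-ℝ (ε /2)))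

  parameters : ∀ ε → 0ℝ ≤ℝ ε → ε ≤ℝ 1ℝ → ∀ n .{{_ : NonZero n}} → Parameters ε n
  parameters ε 0≤ε ε≤1 n with Grid.grid ε 0≤ε ε≤1 ⌊log₂ n ⌋
  ... | k , k≤ℓ , low , high with half (⌊log₂ n ⌋ ∸ k)
  ...   | d , lo , hi = record
    { k = k ; d = d ; n≤D²K = n≤D²K
    ; edge-budget     = Grid.edge-budget ε 0≤ε ε≤1 {k = k} (2^⌊log₂n⌋≤n n) low
    ; distance-budget = Grid.distance-budget ε 0≤ε ε≤1 {k = k} (2^⌊log₂n⌋≤n n) {d = d}
        (≤-trans (+-monoˡ-≤ k hi) (≤-reflexive (cong (2 +_) (m∸n+n≡m k≤ℓ)))) high
    }
    where
    open ≤-Reasoning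
    n≤D²K : n ≤ 2 ^ d * 2 ^ d * 2 ^ k
    n≤D²K = begin
      n                                ≤⟨ <⇒≤ (n<2^[1+⌊log₂n⌋] n) ⟩
      2 ^ suc ⌊log₂ n ⌋                ≡⟨ cong (λ l → 2 ^ suc l) (sym (m∸n+n≡m k≤ℓ)) ⟩
      2 ^ (suc (⌊log₂ n ⌋ ∸ k) + k)    ≤⟨ ^-monoʳ-≤ 2 (+-monoˡ-≤ k lo) ⟩
      2 ^ (2 * d + k)                  ≡⟨ ^-distribˡ-+-* 2 (2 * d) k ⟩
      2 ^ (2 * d) * 2 ^ k              ≡⟨ cong (λ e → 2 ^ (d + e) * 2 ^ k) (+-identityʳ d) ⟩
      2 ^ (d + d) * 2 ^ k              ≡⟨ cong (_* 2 ^ k) (^-distribˡ-+-* 2 d d) ⟩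
      2 ^ d * 2 ^ d * 2 ^ k            ∎

  module _ {n} {G H : Graph n} (H⊆G : H ⊆ G) where

    δ-mono : ∀ u v → δ G u v ≤⁺ δ H u v
    δ-mono u v with distance G u v | distance H u v
    ... | g , _               | ⊤⁺ , _        = g ≤⊤⁺
    ... | ⊤⁺ , unreachable    | [ h ] , p , _ = contradiction (mapʷ H⊆G p) (unreachable h)
    ... | [ g ] , _ , minimal | [ h ] , p , _ = [ minimal h (mapʷ H⊆G p) ]

    δ-distortion : ∀ {Δ c x} → (∀ {d u v} → Walk G d u v → Geodesic G d u v → Near H (d + Δ) u v) →
                   (∀ {m} → m ≤ Δ → m ≤ c · n ^ℝ x) → ∀ u v → _≤_+_·_^ℝ_ (δ H u v) (δ G u v) c n x
    δ-distortion near bound u v with distance G u v | distance H u v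
    ... | ⊤⁺ , _        | _                   = tt
    ... | [ g ] , p , m | ⊤⁺ , unreachable    = let l , _ , q = near p m in unreachable l q
    ... | [ g ] , p , m | [ h ] , _ , minimal = bound
      (let l , l≤g+Δ , q = near p m in m≤n+o⇒m∸n≤o h g (≤-trans (minimal l q) l≤g+Δ))

  -- The factor `2 * (8 + (L + L))` multiplies `D` in `spanner-distortion`, and 4 is the constant in
  -- the bound on `D`.
  distortion : ℕ → ℕ
  distortion n = 2 * (8 + (L + L)) * 4
    where L = suc ⌊log₂ n ⌋

  distortion-polylog : Polylog distortion
  -- The value is `80 + 16 * l` with `l` the rounded logarithm; `n ≥ 2` ensures `1 ≤ l`, whence
  -- `96 = 80 + 16`.
  distortion-polylog = 1 , 96 , 2 , λ n 2≤n → bound ⌊log₂ n ⌋ (1≤⌊log₂n⌋ 2≤n)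
    where
    open ≤-Reasoning
    bound : ∀ l → 1 ≤ l → 2 * (8 + (suc l + suc l)) * 4 ≤ 96 * l ^ 1
    bound l 1≤l = begin
      2 * (8 + (suc l + suc l)) * 4
        ≡⟨ solve 1 (λ l → con 2 :* (con 8 :+ (con 1 :+ l :+ (con 1 :+ l))) :* con 4 := con 80 :* con 1 :+ con 16 :* l) refl l ⟩
      80 * 1 + 16 * l  ≤⟨ +-monoˡ-≤ (16 * l) (*-monoʳ-≤ 80 1≤l) ⟩
      80 * l + 16 * l  ≡⟨ solve 1 (λ l → con 80 :* l :+ con 16 :* l := con 96 :* (l :* con 1)) refl l ⟩
      96 * l ^ 1       ∎

  additive-spanner : (ε : ℝ) → 0ℝ ≤ℝ ε → ε ≤ℝ 1ℝ → (n : ℕ) (G : Graph n) → ∃ λ (H : Graph n) →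
    H ⊆ G × ∣E H ∣ ≤ 24 · n ^ℝ (1ℚ +ℝ ε) ×
    (∀ u v → δ G u v ≤⁺ δ H u v × _≤_+_·_^ℝ_ (δ H u v) (δ G u v) (distortion n) n (½ +ℝ (-ℝ (ε /2))))
  -- Without vertices there are no edges and no pairs; this case is separate because
  -- `2 ^ ⌊log₂ n ⌋ ≤ n` fails at 0.
  additive-spanner ε 0≤ε ε≤1 zero G = G , (λ e → e) , zero-≤-^ℝ 24 0 (1ℚ +ℝ ε) , λ ()
  additive-spanner ε 0≤ε ε≤1 n@(suc _) G =
    spanner n≤D²K , (λ {u} {v} → H⊆G {u} {v}) ,
    -- `24 = 12 * 2`: the factor from `spanner-size` times the constant of `edge-budget`.
    ^ℝ-scale 12 {x = 1ℚ +ℝ ε} edge-budget (spanner-size n≤D²K) ,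
    λ u v → δ-mono {H = spanner n≤D²K} H⊆G u v ,
            δ-distortion {H = spanner n≤D²K} H⊆G {x = ½ +ℝ (-ℝ (ε /2))} (spanner-distortion n≤D²K)
              (λ m≤Δ → ^ℝ-scale (2 * (8 + (L + L))) {x = ½ +ℝ (-ℝ (ε /2))} distance-budget
                          (≤-trans m≤Δ (≤-reflexive (solve 2 (λ D B → (D :+ D) :* B := con 2 :* B :* D) refl (2 ^ d) (8 + (L + L)))))) u v
    where
    open Parameters (parameters ε 0≤ε ε≤1 n)
    L = suc ⌊log₂ n ⌋
    open Construction G (2 ^ k) (2 ^ d) L (n<2^[1+⌊log₂n⌋] n)
    instance
      K≢0 : NonZero (2 ^ k)
      K≢0 = m^n≢0 2 k
      D≢0 : NonZero (2 ^ d)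
      D≢0 = m^n≢0 2 d
    H⊆G : spanner n≤D²K ⊆ G
    H⊆G = proj₁

open AdditiveSpanners

theorem1 : ∃ λ (f : ℕ → ℕ) → ∃ λ (c : ℕ) → Polylog f × 0 < c ×
    ((ε : ℝ) → 0ℝ ≤ℝ ε → ε ≤ℝ 1ℝ →
    (n : ℕ) (G : Graph n) →
    ∃ λ (H : Graph n) →
    H ⊆ G ×
    ∣E H ∣ ≤ c · n ^ℝ (1ℚ +ℝ ε) ×
    (∀ u v → δ G u v ≤⁺ δ H u v ×
    δ H u v ≤ δ G u v + f n · n ^ℝ (½ +ℝ (-ℝ (ε /2)))))
theorem1 = distortion , 24 , distortion-polylog , z<s , additive-spanner
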